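{- Suppose a randomized algorithm knows the number $n$ of vertices of an unknown graph $G=(V,E)$. Suppose it has access to the $\mathbf{RandVert}$, $\mathbf{RandNbr}$, $\mathbf{Degree}$ and $\mathbf{RandEdge}$ oracles, and with probability $>2/3$ returns an $O(1)$-approximation to $d$. Then: (a) if it has no other oracle access, the algorithm must make $\Omega(n^{1/3})$ queries; (b) if it additionally has access to the $\mathbf{Pair}$ oracle, the algorithm must make $\Omega(n^{1/4})$ queries; (c) if it additionally has access to the $\mathbf{FullNbrHood}$ oracle, the algorithm must make $\Omega(n^{1/5})$ queries.
   Context: $G$ is a simple undirected graph with $n$ vertices and $m$ edges, and $d=2m/n$ is its average degree. The oracles, each of unit cost, are: - $\mathbf{RandVert}()$ returns a uniformly random vertex. - $\mathbf{RandNbr}(x)$ returns a uniformly random neighbor of $x$. - $\mathbf{Degree}(x)$ returns $\deg(x)$. - $\mathbf{RandEdge}()$ returns a uniformly random edge. - $\mathbf{Pair}(x,y)$ returns whether $\{x,y\}\in E$. - $\mathbf{FullNbrHood}(x)$ returns the full adjacency list of $x$. An $O(1)$-approximation to $d$ is a value in $[d/c,cd]$ for some constant $c\ge 1$. -}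

module Defs where

open import Data.Bool using (Bool; true; false; T; if_then_else_)
open import Data.Nat using (ℕ; zero; suc; _^_) renaming (_*_ to _*ℕ_; _≤_ to _≤ℕ_)
open import Data.Fin using (Fin)
open import Data.Fin.Properties using (_<?_)
open import Data.List using (List; []; _∷_; length; filter; map; concatMap; foldr)
open import Data.List.Base using (allFin)
open import Data.Maybe using (Maybe; just; nothing)
open import Data.Product using (_×_; _,_; Σ; ∃; ∃-syntax)
open import Data.Integer using (+_)
open import Data.Rational using (ℚ; 0ℚ; 1ℚ; _/_; _+_; _*_; _≤_; _<_)
open import Data.Rational.Properties using (_≤?_)
open import Relation.Nullary.Decidable using (⌊_⌋; _×-dec_)
open import Relation.Binary.PropositionalEquality using (_≡_)

record Graph (n : ℕ) : Set where
  field
    adj    : Fin n → Fin n → Bool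
    sym    : ∀ x y → adj x y ≡ adj y x
    irrefl : ∀ x → adj x x ≡ false
open Graph public

nbrs : ∀ {n} → Graph n → Fin n → List (Fin n)
nbrs G x = filter (λ y → T? (adj G x y)) (allFin _)
  where
  open import Data.Bool.Properties using (T?)

degree : ∀ {n} → Graph n → Fin n → ℕ
degree G x = length (nbrs G x)

edges : ∀ {n} → Graph n → List (Fin n × Fin n)
edges {n} G = concatMap (λ u → map (λ v → (u , v))
                          (filter (λ v → u <? v) (nbrs G u))) (allFin n)

numEdges : ∀ {n} → Graph n → ℕ
numEdges G = length (edges G)

avgDeg : ∀ {n} → Graph (suc n) → ℚ
avgDeg {n} G = (+ (2 *ℕ numEdges G)) / suc n

data Query (n : ℕ) : Set where
  randVert : Query n
  randNbr  : Fin n → Query n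
  deg      : Fin n → Query n
  randEdge : Query n
  pair     : Fin n → Fin n → Query n
  fullNbr  : Fin n → Query n

-- response types (nothing = "no neighbour" / "no edge" for the degenerate cases)
Resp : ∀ {n} → Query n → Set
Resp {n} randVert    = Fin n
Resp {n} (randNbr x) = Maybe (Fin n)
Resp (deg x)         = ℕ
Resp {n} randEdge    = Maybe (Fin n × Fin n)
Resp (pair x y)      = Bool
Resp {n} (fullNbr x) = List (Fin n)

-- The answer of an oracle is uniformly distributed over the returned list.
answers : ∀ {n} → Graph n → (q : Query n) → List (Resp q)
answers {n} G randVert = allFin n
answers G (randNbr x) with nbrs G x
... | []     = nothing ∷ []
... | y ∷ ys = map just (y ∷ ys)
answers G (deg x) = degree G x ∷ []
answers G randEdge with edges G
... | []     = nothing ∷ []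
... | e ∷ es = map just (e ∷ es)
answers G (pair x y) = adj G x y ∷ []
answers G (fullNbr x) = nbrs G x ∷ []

data Access : Set where
  basic    : Access
  withPair : Access
  withFull : Access

Allowed : ∀ {n} → Access → Query n → Set
Allowed a        randVert    = Data.Unit.⊤ where import Data.Unit
Allowed a        (randNbr x) = Data.Unit.⊤ where import Data.Unit
Allowed a        (deg x)     = Data.Unit.⊤ where import Data.Unit
Allowed a        randEdge    = Data.Unit.⊤ where import Data.Unit
Allowed basic    (pair x y)  = Data.Empty.⊥ where import Data.Empty
Allowed withPair (pair x y)  = Data.Unit.⊤ where import Data.Unit
Allowed withFull (pair x y)  = Data.Unit.⊤ where import Data.Unit
Allowed basic    (fullNbr x) = Data.Empty.⊥ where import Data.Empty
Allowed withPair (fullNbr x) = Data.Empty.⊥ where import Data.Empty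
Allowed withFull (fullNbr x) = Data.Unit.⊤ where import Data.Unit

-- Randomized query algorithms (knowing n) as decision trees:
-- internal fair choices among (suc k) options, oracle queries, and a rational output.

data Alg (a : Access) (n : ℕ) : Set where
  output : ℚ → Alg a n
  coin   : (k : ℕ) → (Fin (suc k) → Alg a n) → Alg a n
  query  : (q : Query n) → Allowed a q → (Resp q → Alg a n) → Alg a n

data QueriesAtMost {a n} : ℕ → Alg a n → Set where
  out : ∀ {k r} → QueriesAtMost k (output r)
  cn  : ∀ {k j f} → (∀ i → QueriesAtMost k (f i)) → QueriesAtMost k (coin j f)
  qu  : ∀ {k q p f} → (∀ r → QueriesAtMost k (f r)) → QueriesAtMost (suc k) (query q p f)

average : List ℚ → ℚ
average []       = 0ℚ
average (x ∷ xs) = foldr _+_ 0ℚ (x ∷ xs) * ((+ 1) / suc (length xs))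

Approx : ℕ → ℚ → ℚ → Set
Approx c d r = (d ≤ (+ c / 1) * r) × (r ≤ (+ c / 1) * d)

approx? : ∀ c d r → Bool
approx? c d r = ⌊ (d ≤? (+ c / 1) * r) ×-dec (r ≤? (+ c / 1) * d) ⌋

successProb : ∀ {a n} → ℕ → Graph (suc n) → Alg a (suc n) → ℚ
successProb c G (output r)    = if approx? c (avgDeg G) r then 1ℚ else 0ℚ
successProb c G (coin k f)    = average (map (λ i → successProb c G (f i)) (allFin (suc k)))
successProb c G (query q p f) = average (map (λ r → successProb c G (f r)) (answers G q))

-- Ω(n^{1/e}) lower bound for access model a:
-- for every constant c ≥ 1 there are C ≥ 1 and n₀ such that for all n ≥ n₀,
-- every algorithm that on every n-vertex graph outputs a c-approximation of d
-- with probability > 2/3 makes k queries with n ≤ C·k^e  (i.e. k ≥ (n/C)^{1/e}).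

LowerBound : Access → ℕ → Set
LowerBound a e =
  ∀ (c : ℕ) → 1 ≤ℕ c →
  ∃[ C ] ∃[ n₀ ] (1 ≤ℕ C) ×
    (∀ (n : ℕ) → n₀ ≤ℕ suc n →
     ∀ (A : Alg a (suc n)) (k : ℕ) → QueriesAtMost k A →
     (∀ (G : Graph (suc n)) → ((+ 2) / 3) < successProb c G A) →
     suc n ≤ℕ C *ℕ k ^ e)

{-# OPTIONS --safe #-}
module Submission where

-- One construction serves all three access models, even with exponent 3.  Fix M disjoint pairs
-- of vertices ("slots"), arranged as T cells of B slots, and let the graph be the matching that
-- contains one uniformly random slot of every cell.  An ideal oracle ignores the graph: it
-- answers randEdge with a uniformly random slot, and every other query from the edges shown so
-- far.  Until randEdge repeats a cell (chance at most k/T per query) or a query at a vertex hits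
-- an unseen edge (chance at most 1/B per query), the true oracle behaves like the ideal one, so k
-- queries cost at most k/B + k²/T in success probability.  The ideal oracle only depends on
-- M = T B.  With L = c² + 1, the shapes (T, L B) and (T L, B) share the same M, but their average
-- degrees differ by the factor L > c², so no output is good for both.  Taking B of order k and T
-- of order k² needs only order k³ vertices.
--
-- No conditioning is needed: replacing the true answer by the ideal one for every graph costs at
-- most the probability that they differ, since success probabilities lie in [0, 1].
open import Defs
open import Algebra.Bundles using (CommutativeMonoid)
open import Data.Bool using (Bool; true; false; if_then_else_; T; _∨_)
open import Data.Bool.Properties using (T?; ∨-identityʳ)
open import Data.Fin as Fin using (Fin; zero; suc; toℕ; inject≤; _↑ʳ_; combine; remQuot; cast)
open import Data.Fin.Properties as Fin
  using (_≟_; any?; _<?_; toℕ-inject≤; toℕ-↑ʳ; toℕ-injective; toℕ<n; combine-remQuot; remQuot-combine; cast-involutive)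
open import Data.Integer as ℤ using () renaming (+_ to pos)
import Data.Integer.Properties as ℤ
open import Data.List using (List; []; _∷_; _++_; length; map; foldr; filter; tabulate; allFin; cartesianProduct)
open import Data.List.Membership.Propositional using (_∈_; lose; find)
open import Data.List.Membership.Propositional.Properties
  using (∈-map⁺; ∈-map⁻; ∈-filter⁺; ∈-filter⁻; ∈-allFin; ∈-concatMap⁺; ∈-concatMap⁻; ∈-cartesianProduct⁺)
open import Data.List.Membership.Propositional.Properties.WithK using (unique∧set⇒bag)
open import Data.List.Properties using (length-map; length-++; length-tabulate; map-∘; map-cong; map-tabulate; filter-≐)
open import Data.List.Relation.Binary.BagAndSetEquality using (∼bag⇒↭)
open import Data.List.Relation.Binary.Permutation.Propositional using (_↭_; refl; prep; swap; trans)
open import Data.List.Relation.Binary.Permutation.Propositional.Properties using (↭-length)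
open import Data.List.Relation.Unary.All as All using (All; []; _∷_)
import Data.List.Relation.Unary.All.Properties as All
import Data.List.Relation.Unary.AllPairs as AllPairs
import Data.List.Relation.Unary.AllPairs.Properties as AllPairs
open import Data.List.Relation.Unary.Unique.Propositional using (Unique; []; _∷_)
import Data.List.Relation.Unary.Unique.Propositional.Properties as Unique
open import Data.Maybe using (Maybe; just; nothing; is-just)
open import Data.Nat as ℕ using (ℕ; zero; suc; pred)
import Data.Nat.Properties as ℕ
open import Data.Nat.Solver using (module +-*-Solver)
open import Data.Product using (_×_; _,_; proj₁; proj₂; ∃; uncurry)
open import Data.Rational as ℚ using (ℚ; 0ℚ; 1ℚ; _/_; _+_; _*_; _≤_; _<_; toℚᵘ; NonNegative)
open import Data.Rational.Properties as ℚ hiding (_≟_; _<?_)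
open import Data.Rational.Unnormalised as ℚᵘ using (mkℚᵘ; *≡*; *≤*)
import Data.Rational.Unnormalised.Properties as ℚᵘ
open import Data.Sum using (_⊎_; inj₁; inj₂)
open import Data.Vec as Vec using (Vec; []; _∷_; lookup; _[_]≔_; replicate)
open import Data.Vec.Properties using (lookup∘update; lookup∘update′; lookup-replicate)
open import Function using (_∘_; id; mk⇔)
open import Relation.Binary.Definitions using (DecidableEquality)
open import Relation.Binary.PropositionalEquality as ≡ using (_≡_; _≢_; _≗_; cong; cong₂; subst)
open import Relation.Nullary using (¬_; contradiction)
open import Relation.Nullary.Decidable
  using (Dec; yes; no; does; does-⇔; dec-false; ⌊_⌋; from-no; _×-dec_; _⊎-dec_)
open import Algebra.Properties.CommutativeSemigroup (CommutativeMonoid.commutativeSemigroup ℚ.+-0-commutativeMonoid)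
  using (interchange; x∙yz≈y∙xz)

private variable
  A A′ : Set
  b m n : ℕ

-- Means over lists

-- Opaque because conversion checking would otherwise unfold the gcd normalisation of fractions.
abstract
  fromℕ : ℕ → ℚ
  fromℕ n = pos n / 1

  -- This is 1/n, with the value 0 at 0 because the `average` of the empty list is 0; so `mean≡∑`
  -- and `weight-*` hold for all lengths.
  weight : ℕ → ℚ
  weight zero    = 0ℚ
  weight (suc n) = pos 1 / suc n

  toℚᵘ-/ : ∀ i n → toℚᵘ (i / suc n) ℚᵘ.≃ mkℚᵘ i n
  toℚᵘ-/ i n = toℚᵘ-fromℚᵘ (mkℚᵘ i n)

  fromℕ-zero : fromℕ 0 ≡ 0ℚ
  fromℕ-zero = ≡.refl

  fromℕ-nonNeg : ∀ n → 0ℚ ≤ fromℕ n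
  fromℕ-nonNeg n = nonNegative⁻¹ (fromℕ n) {{normalize-nonNeg n 1}}

  weight-suc : ∀ n → weight (suc n) ≡ pos 1 / suc n
  weight-suc n = ≡.refl

  fromℕ-suc : ∀ n → fromℕ (suc n) ≡ 1ℚ + fromℕ n
  fromℕ-suc n = toℚᵘ-injective (begin
    toℚᵘ (fromℕ (suc n))                ≈⟨ toℚᵘ-/ (pos (suc n)) 0 ⟩
    mkℚᵘ (pos (suc n)) 0                    ≈⟨ *≡* (cong (λ i → pos (suc i) ℤ.* pos 1) (≡.sym (ℕ.*-identityʳ n))) ⟩
    mkℚᵘ (pos (suc (n ℕ.* 1))) 0            ≈⟨ *≡* (cong (ℤ._* pos 1) (ℤ.pos-+ 1 (n ℕ.* 1))) ⟩
    mkℚᵘ (pos 1 ℤ.+ pos (n ℕ.* 1)) 0        ≈⟨ *≡* (cong (λ i → (pos 1 ℤ.+ i) ℤ.* pos 1) (ℤ.pos-* n 1)) ⟩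
    mkℚᵘ (pos 1) 0 ℚᵘ.+ mkℚᵘ (pos n) 0      ≈⟨ ℚᵘ.+-congʳ (mkℚᵘ (pos 1) 0) (toℚᵘ-/ (pos n) 0) ⟨
    toℚᵘ 1ℚ ℚᵘ.+ toℚᵘ (fromℕ n)         ≈⟨ toℚᵘ-homo-+ 1ℚ (fromℕ n) ⟨
    toℚᵘ (1ℚ + fromℕ n)                 ∎)
    where open ℚᵘ.≃-Reasoning

  weight-* : ∀ m n → weight (m ℕ.* n) ≡ weight m * weight n
  weight-* zero    n       = ≡.sym (*-zeroˡ (weight n))
  weight-* (suc m) zero    = ≡.trans (cong weight (ℕ.*-zeroʳ m)) (≡.sym (*-zeroʳ (weight (suc m))))
  weight-* (suc m) (suc n) = toℚᵘ-injective (begin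
    toℚᵘ (weight (suc m ℕ.* suc n))              ≈⟨ toℚᵘ-/ (pos 1) (n ℕ.+ m ℕ.* suc n) ⟩
    mkℚᵘ (pos 1) m ℚᵘ.* mkℚᵘ (pos 1) n               ≈⟨ ℚᵘ.*-cong (toℚᵘ-/ (pos 1) m) (toℚᵘ-/ (pos 1) n) ⟨
    toℚᵘ (weight (suc m)) ℚᵘ.* toℚᵘ (weight (suc n)) ≈⟨ toℚᵘ-homo-* (weight (suc m)) (weight (suc n)) ⟨
    toℚᵘ (weight (suc m) * weight (suc n))       ∎)
    where open ℚᵘ.≃-Reasoning

  -- Cross-multiplication. It later bounds the collision chance of one query by 1/B and the
  -- accumulated error k/B by 1/7.
  fromℕ*weight≤weight : ∀ a d T → a ℕ.* suc d ℕ.≤ suc T → fromℕ a * weight (suc T) ≤ weight (suc d)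
  fromℕ*weight≤weight a d T le = toℚᵘ-cancel-≤ (begin
    toℚᵘ (fromℕ a * weight (suc T))         ≃⟨ toℚᵘ-homo-* (fromℕ a) (weight (suc T)) ⟩
    toℚᵘ (fromℕ a) ℚᵘ.* toℚᵘ (weight (suc T)) ≃⟨ ℚᵘ.*-cong (toℚᵘ-/ (pos a) 0) (toℚᵘ-/ (pos 1) T) ⟩
    mkℚᵘ (pos a) 0 ℚᵘ.* mkℚᵘ (pos 1) T          ≤⟨ *≤* (ℤ.≤-trans (ℤ.≤-reflexive lhs) (ℤ.≤-trans (ℤ.+≤+ le) (ℤ.≤-reflexive rhs))) ⟩
    mkℚᵘ (pos 1) d                            ≃⟨ toℚᵘ-/ (pos 1) d ⟨
    toℚᵘ (weight (suc d))                   ∎)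
    where
    open ℚᵘ.≤-Reasoning
    lhs : (pos a ℤ.* pos 1) ℤ.* pos (suc d) ≡ pos (a ℕ.* suc d)
    lhs = ≡.trans (cong (ℤ._* pos (suc d)) (ℤ.*-identityʳ (pos a))) (≡.sym (ℤ.pos-* a (suc d)))
    rhs : pos (suc T) ≡ pos 1 ℤ.* pos (suc (T ℕ.+ 0))
    rhs = ≡.trans (cong (λ i → pos (suc i)) (≡.sym (ℕ.+-identityʳ T))) (≡.sym (ℤ.*-identityˡ _))

  weight-nonNeg : ∀ n → NonNegative (weight n)
  weight-nonNeg zero    = _
  weight-nonNeg (suc n) = normalize-nonNeg 1 (suc n)

  fromℕ*weight : ∀ n → fromℕ (suc n) * weight (suc n) ≡ 1ℚ
  fromℕ*weight n = toℚᵘ-injective (begin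
    toℚᵘ (fromℕ (suc n) * weight (suc n))             ≈⟨ toℚᵘ-homo-* (fromℕ (suc n)) (weight (suc n)) ⟩
    toℚᵘ (fromℕ (suc n)) ℚᵘ.* toℚᵘ (weight (suc n))   ≈⟨ ℚᵘ.*-cong (toℚᵘ-/ (pos (suc n)) 0) (toℚᵘ-/ (pos 1) n) ⟩
    mkℚᵘ (pos (suc n)) 0 ℚᵘ.* mkℚᵘ (pos 1) n                ≈⟨ *≡* (≡.trans (ℤ.*-identityʳ _) (≡.trans (ℤ.*-identityʳ _) (≡.sym (≡.trans (ℤ.*-identityˡ _) (cong (λ i → pos (suc i)) (ℕ.+-identityʳ n)))))) ⟩
    mkℚᵘ (pos 1) 0                                      ∎)
    where open ℚᵘ.≃-Reasoning

∑ : List A → (A → ℚ) → ℚ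
∑ xs f = foldr _+_ 0ℚ (map f xs)

∑-cong : ∀ (xs : List A) {f g} → f ≗ g → ∑ xs f ≡ ∑ xs g
∑-cong xs f≗g = cong (foldr _+_ 0ℚ) (map-cong f≗g xs)

∑-mono : ∀ (xs : List A) {f g} → (∀ x → f x ≤ g x) → ∑ xs f ≤ ∑ xs g
∑-mono []       f≤g = ≤-refl
∑-mono (x ∷ xs) f≤g = +-mono-≤ (f≤g x) (∑-mono xs f≤g)

∑-+ : ∀ (xs : List A) f g → ∑ xs (λ x → f x + g x) ≡ ∑ xs f + ∑ xs g
∑-+ []       f g = ≡.refl
∑-+ (x ∷ xs) f g = ≡.trans (cong ((f x + g x) +_) (∑-+ xs f g)) (interchange (f x) (g x) _ _)

∑-* : ∀ (xs : List A) f q → ∑ xs (λ x → f x * q) ≡ ∑ xs f * q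
∑-* []       f q = ≡.sym (*-zeroˡ q)
∑-* (x ∷ xs) f q = ≡.trans (cong ((f x * q) +_) (∑-* xs f q)) (≡.sym (*-distribʳ-+ q (f x) _))

∑-0 : ∀ (xs : List A) → ∑ xs (λ _ → 0ℚ) ≡ 0ℚ
∑-0 []       = ≡.refl
∑-0 (x ∷ xs) = ≡.trans (+-identityˡ _) (∑-0 xs)

∑-const : ∀ (xs : List A) q → ∑ xs (λ _ → q) ≡ fromℕ (length xs) * q
∑-const []       q = ≡.sym (≡.trans (cong (_* q) fromℕ-zero) (*-zeroˡ q))
∑-const (x ∷ xs) q = begin
  q + ∑ xs (λ _ → q)                ≡⟨ cong₂ _+_ (≡.sym (*-identityˡ q)) (∑-const xs q) ⟩
  1ℚ * q + fromℕ (length xs) * q    ≡⟨ *-distribʳ-+ q 1ℚ (fromℕ (length xs)) ⟨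
  (1ℚ + fromℕ (length xs)) * q      ≡⟨ cong (_* q) (fromℕ-suc (length xs)) ⟨
  fromℕ (suc (length xs)) * q       ∎
  where open ≡.≡-Reasoning

∑-swap : ∀ (xs : List A) (ys : List A′) (f : A → A′ → ℚ) → ∑ xs (λ x → ∑ ys (f x)) ≡ ∑ ys (λ y → ∑ xs (λ x → f x y))
∑-swap []       ys f = ≡.sym (∑-0 ys)
∑-swap (x ∷ xs) ys f = ≡.trans (cong (∑ ys (f x) +_) (∑-swap xs ys f)) (≡.sym (∑-+ ys (f x) _))

∑-++ : ∀ (xs ys : List A) f → ∑ (xs ++ ys) f ≡ ∑ xs f + ∑ ys f
∑-++ []       ys f = ≡.sym (+-identityˡ _)
∑-++ (x ∷ xs) ys f = ≡.trans (cong (f x +_) (∑-++ xs ys f)) (≡.sym (+-assoc (f x) _ _))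

∑-map : ∀ (g : A → A′) xs f → ∑ (map g xs) f ≡ ∑ xs (f ∘ g)
∑-map g xs f = cong (foldr _+_ 0ℚ) (≡.sym (map-∘ xs))

∑-↭ : ∀ {xs ys : List A} → xs ↭ ys → ∀ f → ∑ xs f ≡ ∑ ys f
∑-↭ refl         f = ≡.refl
∑-↭ (prep x p)   f = cong (f x +_) (∑-↭ p f)
∑-↭ (swap x y p) f = ≡.trans (x∙yz≈y∙xz (f x) (f y) _) (cong (λ s → f y + (f x + s)) (∑-↭ p f))
∑-↭ (trans p q)  f = ≡.trans (∑-↭ p f) (∑-↭ q f)

∑-cartesianProduct : ∀ (xs : List A) (ys : List A′) f →
                     ∑ (cartesianProduct xs ys) f ≡ ∑ xs (λ x → ∑ ys (λ y → f (x , y)))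
∑-cartesianProduct []       ys f = ≡.refl
∑-cartesianProduct (x ∷ xs) ys f =
  ≡.trans (∑-++ (map (x ,_) ys) _ f) (cong₂ _+_ (∑-map (x ,_) ys f) (∑-cartesianProduct xs ys f))

abstract
  mean : List A → (A → ℚ) → ℚ
  mean xs f = average (map f xs)

  average≡mean : ∀ (xs : List A) f → average (map f xs) ≡ mean xs f
  average≡mean xs f = ≡.refl

  mean-[] : ∀ (f : A → ℚ) → mean [] f ≡ 0ℚ
  mean-[] f = ≡.refl

  mean-map : ∀ (g : A → A′) xs f → mean (map g xs) f ≡ mean xs (f ∘ g)
  mean-map g xs f = cong average (≡.sym (map-∘ xs))

  mean≡∑ : ∀ (xs : List A) f → mean xs f ≡ ∑ xs f * weight (length xs)
  mean≡∑ []       f = ≡.refl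
  mean≡∑ (x ∷ xs) f = cong (λ n → ∑ (x ∷ xs) f * weight (suc n)) (length-map f xs)

  mean-cong : ∀ (xs : List A) {f g} → f ≗ g → mean xs f ≡ mean xs g
  mean-cong xs f≗g = cong average (map-cong f≗g xs)

mean-mono : ∀ (xs : List A) {f g} → (∀ x → f x ≤ g x) → mean xs f ≤ mean xs g
mean-mono xs {f} {g} f≤g = ≡.subst₂ _≤_ (≡.sym (mean≡∑ xs f)) (≡.sym (mean≡∑ xs g))
  (*-monoʳ-≤-nonNeg (weight (length xs)) {{weight-nonNeg (length xs)}} (∑-mono xs f≤g))

mean-+ : ∀ (xs : List A) f g → mean xs (λ x → f x + g x) ≡ mean xs f + mean xs g
mean-+ xs f g = begin
  mean xs (λ x → f x + g x)                ≡⟨ mean≡∑ xs _ ⟩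
  ∑ xs (λ x → f x + g x) * w               ≡⟨ cong (_* w) (∑-+ xs f g) ⟩
  (∑ xs f + ∑ xs g) * w                    ≡⟨ *-distribʳ-+ w (∑ xs f) (∑ xs g) ⟩
  ∑ xs f * w + ∑ xs g * w                  ≡⟨ cong₂ _+_ (mean≡∑ xs f) (mean≡∑ xs g) ⟨
  mean xs f + mean xs g                    ∎
  where
  open ≡.≡-Reasoning
  w = weight (length xs)

mean-const : ∀ x (xs : List A) q → mean (x ∷ xs) (λ _ → q) ≡ q
mean-const x xs q = begin
  mean (x ∷ xs) (λ _ → q)                        ≡⟨ mean≡∑ (x ∷ xs) (λ _ → q) ⟩
  ∑ (x ∷ xs) (λ _ → q) * weight l                ≡⟨ cong (_* weight l) (∑-const (x ∷ xs) q) ⟩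
  fromℕ l * q * weight l                         ≡⟨ cong (_* weight l) (*-comm (fromℕ l) q) ⟩
  q * fromℕ l * weight l                         ≡⟨ *-assoc q (fromℕ l) (weight l) ⟩
  q * (fromℕ l * weight l)                       ≡⟨ cong (q *_) (fromℕ*weight (length xs)) ⟩
  q * 1ℚ                                         ≡⟨ *-identityʳ q ⟩
  q                                              ∎
  where
  open ≡.≡-Reasoning
  l = suc (length xs)

-- The condition on `q` covers the empty list, whose mean is 0.
mean-upper : ∀ (xs : List A) {f q} → 0ℚ ≤ q → (∀ x → f x ≤ q) → mean xs f ≤ q
mean-upper []       0≤q f≤q = ≤-trans (≤-reflexive (mean-[] _)) 0≤q
mean-upper (x ∷ xs) 0≤q f≤q = ≤-trans (mean-mono (x ∷ xs) f≤q) (≤-reflexive (mean-const x xs _))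

mean-nonNeg : ∀ (xs : List A) {f} → (∀ x → 0ℚ ≤ f x) → 0ℚ ≤ mean xs f
mean-nonNeg []       0≤f = ≤-reflexive (≡.sym (mean-[] _))
mean-nonNeg (x ∷ xs) 0≤f = ≤-trans (≤-reflexive (≡.sym (mean-const x xs 0ℚ))) (mean-mono (x ∷ xs) 0≤f)

-- On the empty list the constant averages to 0 instead of `q`, hence an inequality.
mean-+const : ∀ (xs : List A) f {q} → 0ℚ ≤ q → mean xs (λ x → f x + q) ≤ mean xs f + q
mean-+const xs f {q} 0≤q = ≤-trans (≤-reflexive (mean-+ xs f (λ _ → q)))
  (+-monoʳ-≤ (mean xs f) (mean-upper xs 0≤q (λ _ → ≤-refl)))

-- A normal form for iterated means: exchanging the order and flattening to pairs both become
-- identities of double sums.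
mean-mean : ∀ (xs : List A) (ys : List A′) (f : A → A′ → ℚ) →
            mean xs (λ x → mean ys (f x)) ≡ ∑ xs (λ x → ∑ ys (f x)) * (weight (length xs) * weight (length ys))
mean-mean xs ys f = begin
  mean xs (λ x → mean ys (f x))           ≡⟨ mean≡∑ xs (λ x → mean ys (f x)) ⟩
  ∑ xs (λ x → mean ys (f x)) * w          ≡⟨ cong (_* w) (∑-cong xs (λ x → mean≡∑ ys (f x))) ⟩
  ∑ xs (λ x → ∑ ys (f x) * w′) * w        ≡⟨ cong (_* w) (∑-* xs (λ x → ∑ ys (f x)) w′) ⟩
  ∑ xs (λ x → ∑ ys (f x)) * w′ * w        ≡⟨ *-assoc (∑ xs (λ x → ∑ ys (f x))) w′ w ⟩
  ∑ xs (λ x → ∑ ys (f x)) * (w′ * w)      ≡⟨ cong (∑ xs (λ x → ∑ ys (f x)) *_) (*-comm w′ w) ⟩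
  ∑ xs (λ x → ∑ ys (f x)) * (w * w′)      ∎
  where
  open ≡.≡-Reasoning
  w = weight (length xs)
  w′ = weight (length ys)

mean-swap : ∀ (xs : List A) (ys : List A′) (f : A → A′ → ℚ) →
            mean xs (λ x → mean ys (f x)) ≡ mean ys (λ y → mean xs (λ x → f x y))
mean-swap xs ys f = begin
  mean xs (λ x → mean ys (f x))                        ≡⟨ mean-mean xs ys f ⟩
  ∑ xs (λ x → ∑ ys (f x)) * (w * w′)                   ≡⟨ cong₂ _*_ (∑-swap xs ys f) (*-comm w w′) ⟩
  ∑ ys (λ y → ∑ xs (λ x → f x y)) * (w′ * w)           ≡⟨ mean-mean ys xs (λ y x → f x y) ⟨
  mean ys (λ y → mean xs (λ x → f x y))                ∎
  where
  open ≡.≡-Reasoning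
  w = weight (length xs)
  w′ = weight (length ys)

mean-↭ : ∀ {xs ys : List A} → xs ↭ ys → ∀ f → mean xs f ≡ mean ys f
mean-↭ {xs = xs} {ys} p f = begin
  mean xs f                      ≡⟨ mean≡∑ xs f ⟩
  ∑ xs f * weight (length xs)    ≡⟨ cong₂ (λ s n → s * weight n) (∑-↭ p f) (↭-length p) ⟩
  ∑ ys f * weight (length ys)    ≡⟨ mean≡∑ ys f ⟨
  mean ys f                      ∎
  where open ≡.≡-Reasoning

length-cartesianProduct : ∀ (xs : List A) (ys : List A′) → length (cartesianProduct xs ys) ≡ length xs ℕ.* length ys
length-cartesianProduct []       ys = ≡.refl
length-cartesianProduct (x ∷ xs) ys =
  ≡.trans (length-++ (map (x ,_) ys)) (cong₂ ℕ._+_ (length-map (x ,_) ys) (length-cartesianProduct xs ys))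

mean-cartesianProduct : ∀ (xs : List A) (ys : List A′) f →
                        mean (cartesianProduct xs ys) f ≡ mean xs (λ x → mean ys (λ y → f (x , y)))
mean-cartesianProduct xs ys f = begin
  mean zs f                                        ≡⟨ mean≡∑ zs f ⟩
  ∑ zs f * weight (length zs)                      ≡⟨ cong₂ _*_ (∑-cartesianProduct xs ys f)
                                                        (≡.trans (cong weight (length-cartesianProduct xs ys)) (weight-* (length xs) (length ys))) ⟩
  ∑ xs (λ x → ∑ ys (λ y → f (x , y))) * (weight (length xs) * weight (length ys)) ≡⟨ mean-mean xs ys (λ x y → f (x , y)) ⟨
  mean xs (λ x → mean ys (λ y → f (x , y)))        ∎
  where
  open ≡.≡-Reasoning
  zs = cartesianProduct xs ys

-- Expectation over the completions of a partial assignment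

𝟙 : Bool → ℚ
𝟙 β = if β then 1ℚ else 0ℚ

0≤1 : 0ℚ ≤ 1ℚ
0≤1 = nonNegative⁻¹ 1ℚ

𝟙-nonNeg : ∀ β → 0ℚ ≤ 𝟙 β
𝟙-nonNeg true  = 0≤1
𝟙-nonNeg false = ≤-refl

∑-𝟙-absent : ∀ (_≟ᴬ_ : DecidableEquality A) y xs → All (y ≢_) xs → ∑ xs (λ x → 𝟙 ⌊ x ≟ᴬ y ⌋) ≡ 0ℚ
∑-𝟙-absent _≟ᴬ_ y []       []         = ≡.refl
∑-𝟙-absent _≟ᴬ_ y (x ∷ xs) (y≢x ∷ y∉) with x ≟ᴬ y
... | yes x≡y = contradiction (≡.sym x≡y) y≢x
... | no _    = ≡.trans (+-identityˡ _) (∑-𝟙-absent _≟ᴬ_ y xs y∉)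

∑-𝟙-unique : ∀ (_≟ᴬ_ : DecidableEquality A) y xs → Unique xs → ∑ xs (λ x → 𝟙 ⌊ x ≟ᴬ y ⌋) ≤ 1ℚ
∑-𝟙-unique _≟ᴬ_ y []       []         = 0≤1
∑-𝟙-unique _≟ᴬ_ y (x ∷ xs) (x∉ ∷ uniq) with x ≟ᴬ y
... | yes ≡.refl = ≤-reflexive (≡.trans (cong (1ℚ +_) (∑-𝟙-absent _≟ᴬ_ x xs x∉)) (+-identityʳ 1ℚ))
... | no _       = ≤-trans (≤-reflexive (+-identityˡ _)) (∑-𝟙-unique _≟ᴬ_ y xs uniq)

∑-allFin : ∀ n (f : Fin (suc n) → ℚ) → ∑ (allFin (suc n)) f ≡ f zero + ∑ (allFin n) (f ∘ suc)
∑-allFin n f = cong (f zero +_)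
  (cong (foldr _+_ 0ℚ) (≡.trans (map-tabulate suc f) (≡.sym (map-tabulate id (f ∘ suc)))))

revealed : Vec (Maybe A) m → ℕ
revealed []            = 0
revealed (nothing ∷ H) = revealed H
revealed (just _ ∷ H)  = suc (revealed H)

revealed-nothing : ∀ n → revealed {A = A} (Vec.replicate n nothing) ≡ 0
revealed-nothing zero    = ≡.refl
revealed-nothing (suc n) = revealed-nothing n

revealed-update : ∀ (H : Vec (Maybe A) m) i x → revealed (H [ i ]≔ just x) ℕ.≤ suc (revealed H)
revealed-update (nothing ∷ H) zero    x = ℕ.≤-refl
revealed-update (just _ ∷ H)  zero    x = ℕ.n≤1+n _
revealed-update (nothing ∷ H) (suc i) x = revealed-update H i x
revealed-update (just _ ∷ H)  (suc i) x = ℕ.s≤s (revealed-update H i x)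

∑-is-just : ∀ (H : Vec (Maybe A) m) → ∑ (allFin m) (λ i → 𝟙 (is-just (lookup H i))) ≡ fromℕ (revealed H)
∑-is-just []            = ≡.sym fromℕ-zero
∑-is-just {m = suc m} (nothing ∷ H) =
  ≡.trans (∑-allFin m (λ i → 𝟙 (is-just (lookup (nothing ∷ H) i)))) (≡.trans (+-identityˡ _) (∑-is-just H))
∑-is-just {m = suc m} (just x ∷ H)  = ≡.trans (∑-allFin m (λ i → 𝟙 (is-just (lookup (just x ∷ H) i))))
  (≡.trans (cong (1ℚ +_) (∑-is-just H)) (≡.sym (fromℕ-suc (revealed H))))

-- With entries read as cells, this is the chance that a random edge falls into a cell already
-- revealed.
mean-is-just : ∀ (H : Vec (Maybe A) m) →
               mean (allFin m) (λ i → 𝟙 (is-just (lookup H i))) ≡ fromℕ (revealed H) * weight m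
mean-is-just {m = m} H = ≡.trans (mean≡∑ (allFin m) _)
  (cong₂ (λ s n → s * weight n) (∑-is-just H) (length-tabulate {n = m} id))

-- Conditional expectation over a uniformly random choice given the entries revealed in `H`: hidden
-- entries are averaged independently, revealed ones are fixed. As an iterated mean, it turns
-- conditioning on a further entry into an identity (`𝔼-reveal`).
𝔼 : Vec (Maybe (Fin (suc b))) m → (Vec (Fin (suc b)) m → ℚ) → ℚ
𝔼 []            f = f []
𝔼 (nothing ∷ H) f = mean (allFin _) (λ j → 𝔼 H (λ φ → f (j ∷ φ)))
𝔼 (just j ∷ H)  f = 𝔼 H (λ φ → f (j ∷ φ))

Extends : Vec (Maybe A) m → Vec A m → Set
Extends H φ = ∀ i {j} → lookup H i ≡ just j → lookup φ i ≡ j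

-- The comparison is asked only on the support of the expectation; facts about revealed entries
-- enter through `Extends`.
𝔼-mono : ∀ (H : Vec (Maybe (Fin (suc b))) m) {f g} → (∀ φ → Extends H φ → f φ ≤ g φ) → 𝔼 H f ≤ 𝔼 H g
𝔼-mono []            f≤g = f≤g [] (λ ())
𝔼-mono (nothing ∷ H) f≤g = mean-mono (allFin _) (λ j → 𝔼-mono H (λ φ ext →
  f≤g (j ∷ φ) (λ where zero () ; (suc i) e → ext i e)))
𝔼-mono (just j ∷ H)  f≤g = 𝔼-mono H (λ φ ext →
  f≤g (j ∷ φ) (λ where zero ≡.refl → ≡.refl ; (suc i) e → ext i e))

𝔼-const : ∀ (H : Vec (Maybe (Fin (suc b))) m) q → 𝔼 H (λ _ → q) ≡ q
𝔼-const []            q = ≡.refl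
𝔼-const {b} (nothing ∷ H) q =
  ≡.trans (mean-cong (allFin (suc b)) (λ _ → 𝔼-const H q)) (mean-const {A = Fin (suc b)} zero (tabulate suc) q)
𝔼-const (just _ ∷ H)  q = 𝔼-const H q

𝔼-+ : ∀ (H : Vec (Maybe (Fin (suc b))) m) f g → 𝔼 H (λ φ → f φ + g φ) ≡ 𝔼 H f + 𝔼 H g
𝔼-+ []            f g = ≡.refl
𝔼-+ (nothing ∷ H) f g =
  ≡.trans (mean-cong (allFin _) (λ j → 𝔼-+ H (f ∘ (j ∷_)) (g ∘ (j ∷_))))
          (mean-+ (allFin _) (λ j → 𝔼 H (f ∘ (j ∷_))) (λ j → 𝔼 H (g ∘ (j ∷_))))
𝔼-+ (just j ∷ H)  f g = 𝔼-+ H (f ∘ (j ∷_)) (g ∘ (j ∷_))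

𝔼-mean : ∀ (H : Vec (Maybe (Fin (suc b))) m) (xs : List A) (f : A → Vec (Fin (suc b)) m → ℚ) →
         𝔼 H (λ φ → mean xs (λ x → f x φ)) ≡ mean xs (λ x → 𝔼 H (f x))
𝔼-mean []            xs f = ≡.refl
𝔼-mean (nothing ∷ H) xs f =
  ≡.trans (mean-cong (allFin _) (λ j → 𝔼-mean H xs (λ x φ → f x (j ∷ φ))))
          (mean-swap (allFin _) xs (λ j x → 𝔼 H (λ φ → f x (j ∷ φ))))
𝔼-mean (just j ∷ H)  xs f = 𝔼-mean H xs (λ x φ → f x (j ∷ φ))

-- Law of total expectation. The mean over entry `i` sits under the means over the hidden entries
-- before it, and `mean-swap` moves it to the front.
𝔼-reveal : ∀ (H : Vec (Maybe (Fin (suc b))) m) i f → lookup H i ≡ nothing →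
           𝔼 H f ≡ mean (allFin (suc b)) (λ j → 𝔼 (H [ i ]≔ just j) f)
𝔼-reveal (nothing ∷ H) zero    f _ = ≡.refl
𝔼-reveal (nothing ∷ H) (suc i) f e =
  ≡.trans (mean-cong (allFin _) (λ j → 𝔼-reveal H i (f ∘ (j ∷_)) e))
          (mean-swap (allFin _) (allFin _) (λ j j′ → 𝔼 (H [ i ]≔ just j′) (f ∘ (j ∷_))))
𝔼-reveal (just j ∷ H)  (suc i) f e = 𝔼-reveal H i (f ∘ (j ∷_)) e

-- Once entry `i` is revealed the indicator is constant on each branch, and at most one of the b + 1
-- equally likely values equals `j`.
𝔼-hit : ∀ (H : Vec (Maybe (Fin (suc b))) m) i j → lookup H i ≡ nothing →
        𝔼 H (λ φ → 𝟙 ⌊ lookup φ i ≟ j ⌋) ≤ weight (suc b)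
𝔼-hit {b} H i j e = begin
  𝔼 H (λ φ → 𝟙 ⌊ lookup φ i ≟ j ⌋)
    ≡⟨ 𝔼-reveal H i _ e ⟩
  mean (allFin (suc b)) (λ j′ → 𝔼 (H [ i ]≔ just j′) (λ φ → 𝟙 ⌊ lookup φ i ≟ j ⌋))
    ≤⟨ mean-mono (allFin (suc b)) (λ j′ → ≤-trans
         (𝔼-mono (H [ i ]≔ just j′) (λ φ ext →
           ≤-reflexive (cong (λ k → 𝟙 ⌊ k ≟ j ⌋) (ext i (lookup∘update i H (just j′))))))
         (≤-reflexive (𝔼-const (H [ i ]≔ just j′) (𝟙 ⌊ j′ ≟ j ⌋)))) ⟩
  mean (allFin (suc b)) (λ j′ → 𝟙 ⌊ j′ ≟ j ⌋)
    ≡⟨ mean≡∑ (allFin (suc b)) (λ j′ → 𝟙 ⌊ j′ ≟ j ⌋) ⟩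
  ∑ (allFin (suc b)) (λ j′ → 𝟙 ⌊ j′ ≟ j ⌋) * weight (length (allFin (suc b)))
    ≤⟨ *-monoʳ-≤-nonNeg (weight (length (allFin (suc b)))) {{weight-nonNeg (length (allFin (suc b)))}} (∑-𝟙-unique _≟_ j (allFin (suc b)) (Unique.allFin⁺ (suc b))) ⟩
  1ℚ * weight (length (allFin (suc b)))
    ≡⟨ *-identityˡ _ ⟩
  weight (length (allFin (suc b)))
    ≡⟨ cong weight (length-tabulate {n = suc b} id) ⟩
  weight (suc b)
    ∎
  where open ℚ.≤-Reasoning

-- Matchings

-- Without repetitions, equal membership is equal multiplicity. Descriptions of edges and slots by
-- membership thus become rearrangements, which preserve means.
unique∧⊆⇒↭ : ∀ {xs ys : List A} → Unique xs → Unique ys →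
             (∀ {z} → z ∈ xs → z ∈ ys) → (∀ {z} → z ∈ ys → z ∈ xs) → xs ↭ ys
unique∧⊆⇒↭ xs! ys! xs⊆ys ys⊆xs = ∼bag⇒↭ (unique∧set⇒bag xs! ys! (mk⇔ xs⊆ys ys⊆xs))

T-does⁺ : (P? : Dec A) → A → T (does P?)
T-does⁺ (yes _) _ = _
T-does⁺ (no ¬p) p = contradiction p ¬p

T-does⁻ : (P? : Dec A) → T (does P?) → A
T-does⁻ (yes p) _ = p

∈-nbrs⁺ : ∀ (G : Graph n) {x y} → T (adj G x y) → y ∈ nbrs G x
∈-nbrs⁺ G {x} {y} xy = ∈-filter⁺ (λ z → T? (adj G x z)) (∈-allFin y) xy

∈-nbrs⁻ : ∀ (G : Graph n) {x y} → y ∈ nbrs G x → T (adj G x y)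
∈-nbrs⁻ G {x} y∈ = proj₂ (∈-filter⁻ (λ z → T? (adj G x z)) {xs = allFin _} y∈)

edgesFrom : Graph n → Fin n → List (Fin n × Fin n)
edgesFrom G u = map (u ,_) (filter (u <?_) (nbrs G u))

∈-edgesFrom⁻ : ∀ (G : Graph n) {u} {e} → e ∈ edgesFrom G u → proj₁ e ≡ u × u Fin.< proj₂ e × T (adj G u (proj₂ e))
∈-edgesFrom⁻ G {u} e∈ with ∈-map⁻ (u ,_) e∈
... | v , v∈ , ≡.refl with ∈-filter⁻ (u <?_) v∈
... | v∈nbrs , u<v = ≡.refl , u<v , ∈-nbrs⁻ G v∈nbrs

∈-edges⁺ : ∀ (G : Graph n) {u v} → u Fin.< v → T (adj G u v) → (u , v) ∈ edges G
∈-edges⁺ G {u} {v} u<v uv = ∈-concatMap⁺ (edgesFrom G)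
  (lose (∈-allFin u) (∈-map⁺ (u ,_) (∈-filter⁺ (u <?_) (∈-nbrs⁺ G uv) u<v)))

∈-edges⁻ : ∀ (G : Graph n) {u v} → (u , v) ∈ edges G → u Fin.< v × T (adj G u v)
∈-edges⁻ G e∈ with find (∈-concatMap⁻ (edgesFrom G) {xs = allFin _} e∈)
... | w , _ , e∈w with ∈-edgesFrom⁻ G e∈w
... | ≡.refl , u<v , uv = u<v , uv

edges-unique : ∀ (G : Graph n) → Unique (edges G)
edges-unique {n} G = Unique.concat⁺
  (All.map⁺ (All.universal (λ u → Unique.map⁺ (cong proj₂)
    (Unique.filter⁺ (u <?_) (Unique.filter⁺ (λ z → T? (adj G u z)) (Unique.allFin⁺ n)))) (allFin n)))
  -- Blocks of different vertices are disjoint: each listed pair carries the vertex of its block as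
  -- first component.
  (AllPairs.map⁺ (AllPairs.map (λ u≢u′ {e} (e∈u , e∈u′) →
    u≢u′ (≡.trans (≡.sym (proj₁ (∈-edgesFrom⁻ G e∈u))) (proj₁ (∈-edgesFrom⁻ G e∈u′)))) (Unique.allFin⁺ n)))

nbrs-cong : ∀ (G G′ : Graph n) x → (∀ y → adj G x y ≡ adj G′ x y) → nbrs G x ≡ nbrs G′ x
nbrs-cong G G′ x eq = filter-≐ (λ y → T? (adj G x y)) (λ y → T? (adj G′ x y))
  ((λ {y} → subst T (eq y)) , (λ {y} → subst T (≡.sym (eq y)))) (allFin _)

-- The queries answered from the row of `x` in the adjacency matrix alone. A pair query counts as
-- local at its first argument, whose row already holds the entry.
data LocalAt {n : ℕ} (x : Fin n) : Query n → Set where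
  randNbr : LocalAt x (randNbr x)
  deg     : LocalAt x (deg x)
  pair    : ∀ y → LocalAt x (pair x y)
  fullNbr : LocalAt x (fullNbr x)

answers-cong : ∀ (G G′ : Graph n) {x q} → LocalAt x q → (∀ y → adj G x y ≡ adj G′ x y) → answers G q ≡ answers G′ q
answers-cong G G′ {x} randNbr eq with nbrs G x | nbrs G′ x | nbrs-cong G G′ x eq
... | []    | _ | ≡.refl = ≡.refl
... | _ ∷ _ | _ | ≡.refl = ≡.refl
answers-cong G G′ {x} deg      eq = cong (λ xs → length xs ∷ []) (nbrs-cong G G′ x eq)
answers-cong G G′     (pair y) eq = cong (_∷ []) (eq y)
answers-cong G G′ {x} fullNbr  eq = cong (_∷ []) (nbrs-cong G G′ x eq)

-- Matchings given by a set of vertex-disjoint slots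

module Matching {M N : ℕ} (lo hi : Fin M → Fin N)
  (lo-injective : ∀ {w w′} → lo w ≡ lo w′ → w ≡ w′)
  (hi-injective : ∀ {w w′} → hi w ≡ hi w′ → w ≡ w′)
  (lo<hi : ∀ w → lo w Fin.< hi w)
  (lo≢hi : ∀ w w′ → lo w ≢ hi w′)
  where

  ends : Fin M → Fin N × Fin N
  ends w = lo w , hi w

  Joins : Fin N → Fin N → Fin M → Set
  Joins u v w = (lo w ≡ u × hi w ≡ v) ⊎ (lo w ≡ v × hi w ≡ u)

  joins? : ∀ u v w → Dec (Joins u v w)
  joins? u v w = (lo w ≟ u ×-dec hi w ≟ v) ⊎-dec (lo w ≟ v ×-dec hi w ≟ u)

  Touches : Fin N → Fin M → Set
  Touches x w = lo w ≡ x ⊎ hi w ≡ x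

  Touches-unique : ∀ {x w w′} → Touches x w → Touches x w′ → w ≡ w′
  Touches-unique (inj₁ p) (inj₁ q) = lo-injective (≡.trans p (≡.sym q))
  Touches-unique (inj₁ p) (inj₂ q) = contradiction (≡.trans p (≡.sym q)) (lo≢hi _ _)
  Touches-unique (inj₂ p) (inj₁ q) = contradiction (≡.trans q (≡.sym p)) (lo≢hi _ _)
  Touches-unique (inj₂ p) (inj₂ q) = hi-injective (≡.trans p (≡.sym q))

  Joins⇒Touches : ∀ {u v w} → Joins u v w → Touches u w
  Joins⇒Touches (inj₁ (p , _)) = inj₁ p
  Joins⇒Touches (inj₂ (_ , p)) = inj₂ p

  Joins-sym : ∀ {u v w} → Joins u v w → Joins v u w
  Joins-sym (inj₁ p) = inj₂ p
  Joins-sym (inj₂ p) = inj₁ p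

  ¬Joins-loop : ∀ {x w} → ¬ Joins x x w
  ¬Joins-loop (inj₁ (p , q)) = lo≢hi _ _ (≡.trans p (≡.sym q))
  ¬Joins-loop (inj₂ (p , q)) = lo≢hi _ _ (≡.trans p (≡.sym q))

  Linked : (Fin M → Bool) → Fin N → Fin N → Set
  Linked S u v = ∃ λ w → T (S w) × Joins u v w

  linked? : ∀ S u v → Dec (Linked S u v)
  linked? S u v = any? (λ w → T? (S w) ×-dec joins? u v w)

  matching : (Fin M → Bool) → Graph N
  matching S = record
    { adj    = λ u v → does (linked? S u v)
    ; sym    = λ u v → does-⇔ (mk⇔ (λ (w , s , j) → w , s , Joins-sym j) (λ (w , s , j) → w , s , Joins-sym j))
                              (linked? S u v) (linked? S v u)
    ; irrefl = λ x → dec-false (linked? S x x) (λ (_ , _ , j) → ¬Joins-loop j)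
    }

  edges-matching : ∀ S {xs} → Unique xs → (∀ {w} → w ∈ xs → T (S w)) → (∀ {w} → T (S w) → w ∈ xs) →
                   edges (matching S) ↭ map ends xs
  edges-matching S {xs} xs! sound complete =
    unique∧⊆⇒↭ (edges-unique (matching S)) (Unique.map⁺ (lo-injective ∘ cong proj₁) xs!) to from
    where
    to : ∀ {e} → e ∈ edges (matching S) → e ∈ map ends xs
    to {u , v} e∈ with ∈-edges⁻ (matching S) e∈
    ... | u<v , uv with T-does⁻ {A = Linked S u v} (linked? S u v) uv
    ... | w , s , inj₁ (≡.refl , ≡.refl) = ∈-map⁺ ends (complete s)
    -- `edges` lists each edge with the smaller endpoint first, so a slot cannot occur reversed.
    ... | w , s , inj₂ (≡.refl , ≡.refl) = contradiction (lo<hi w) (Fin.<-asym u<v)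
    from : ∀ {e} → e ∈ map ends xs → e ∈ edges (matching S)
    from e∈ with ∈-map⁻ ends e∈
    ... | w , w∈ , ≡.refl = ∈-edges⁺ (matching S) (lo<hi w)
      (T-does⁺ (linked? S (lo w) (hi w)) (w , sound w∈ , inj₁ (≡.refl , ≡.refl)))

  adj-cong : ∀ S S′ x → (∀ w → Touches x w → S w ≡ S′ w) → ∀ y → adj (matching S) x y ≡ adj (matching S′) x y
  adj-cong S S′ x eq y = does-⇔
    (mk⇔ (λ (w , s , j) → w , subst T (eq w (Joins⇒Touches j)) s , j)
         (λ (w , s , j) → w , subst T (≡.sym (eq w (Joins⇒Touches j))) s , j))
    (linked? S x y) (linked? S′ x y)

  -- The slots are vertex-disjoint, so at most one of them touches `x`. The row of `x` either does
  -- not depend on the set at all or is determined by the presence of that one slot.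
  answers-local : ∀ {x q} → LocalAt x q →
    (∀ S S′ → answers (matching S) q ≡ answers (matching S′) q) ⊎
    (∃ λ w → ∀ S S′ → S w ≡ S′ w → answers (matching S) q ≡ answers (matching S′) q)
  answers-local {x} loc with any? (λ w → (lo w ≟ x) ⊎-dec (hi w ≟ x))
  ... | yes (w , xw) = inj₂ (w , λ S S′ eq → answers-cong (matching S) (matching S′) loc
          (adj-cong S S′ x (λ w′ xw′ → subst (λ z → S z ≡ S′ z) (Touches-unique xw xw′) eq)))
  ... | no ¬xw = inj₁ (λ S S′ → answers-cong (matching S) (matching S′) loc
          (adj-cong S S′ x (λ w xw → contradiction (w , xw) ¬xw)))

-- Comparison with the ideal oracle

-- The target degree is separated from the graph, so that it can be fixed for a whole family while
-- the hidden graph varies.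
accept : ∀ {a n} → ℕ → ℚ → Graph n → Alg a n → ℚ
accept c d G (output r)    = 𝟙 (approx? c d r)
accept c d G (coin k f)    = mean (allFin (suc k)) (λ i → accept c d G (f i))
accept c d G (query q p f) = mean (answers G q) (λ r → accept c d G (f r))

successProb≡accept : ∀ {a n} c (G : Graph (suc n)) (A : Alg a (suc n)) →
                     successProb c G A ≡ accept c (avgDeg G) G A
successProb≡accept c G (output r)    = ≡.refl
successProb≡accept c G (coin k f)    =
  ≡.trans (average≡mean (allFin (suc k)) (λ i → successProb c G (f i)))
          (mean-cong (allFin (suc k)) (λ i → successProb≡accept c G (f i)))
successProb≡accept c G (query q p f) =
  ≡.trans (average≡mean (answers G q) (λ r → successProb c G (f r)))
          (mean-cong (answers G q) (λ r → successProb≡accept c G (f r)))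

accept-nonNeg : ∀ {a n} c d (G : Graph n) (A : Alg a n) → 0ℚ ≤ accept c d G A
accept-nonNeg c d G (output r)    = 𝟙-nonNeg (approx? c d r)
accept-nonNeg c d G (coin k f)    = mean-nonNeg (allFin (suc k)) (λ i → accept-nonNeg c d G (f i))
accept-nonNeg c d G (query q p f) = mean-nonNeg (answers G q) (λ r → accept-nonNeg c d G (f r))

𝟙≤1 : ∀ β → 𝟙 β ≤ 1ℚ
𝟙≤1 true  = ≤-refl
𝟙≤1 false = 0≤1

accept≤1 : ∀ {a n} c d (G : Graph n) (A : Alg a n) → accept c d G A ≤ 1ℚ
accept≤1 c d G (output r)    = 𝟙≤1 (approx? c d r)
accept≤1 c d G (coin k f)    = mean-upper (allFin (suc k)) 0≤1 (λ i → accept≤1 c d G (f i))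
accept≤1 c d G (query q p f) = mean-upper (answers G q) 0≤1 (λ r → accept≤1 c d G (f r))

answers-randEdge : ∀ {n t} (G : Graph n) → numEdges G ≡ suc t → answers G randEdge ≡ map just (edges G)
answers-randEdge G eq with edges G
... | _ ∷ _ = ≡.refl

p≤q+p : ∀ {p q} → 0ℚ ≤ q → p ≤ q + p
p≤q+p {p} {q} 0≤q = ≤-trans (≤-reflexive (≡.sym (+-identityˡ p))) (+-monoˡ-≤ p 0≤q)

p≤p+q : ∀ {p q} → 0ℚ ≤ q → p ≤ p + q
p≤p+q {p} {q} 0≤q = ≤-trans (≤-reflexive (≡.sym (+-identityʳ p))) (+-monoʳ-≤ p 0≤q)

fromℕ-*-nonNeg : ∀ n {ε} → 0ℚ ≤ ε → 0ℚ ≤ fromℕ n * ε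
fromℕ-*-nonNeg n {ε} 0≤ε = ≤-trans (≤-reflexive (≡.sym (*-zeroˡ ε)))
  (*-monoʳ-≤-nonNeg ε {{ℚ.nonNegative 0≤ε}} (fromℕ-nonNeg n))

fromℕ-suc-* : ∀ n ε → fromℕ (suc n) * ε ≡ ε + fromℕ n * ε
fromℕ-suc-* n ε = ≡.trans (cong (_* ε) (fromℕ-suc n))
  (≡.trans (*-distribʳ-+ ε 1ℚ (fromℕ n)) (cong (_+ fromℕ n * ε) (*-identityˡ ε)))

-- What a revealed or hidden cell says about one of its slots: in a hidden cell no slot counts as
-- present.
known : ∀ {b} → Maybe (Fin b) → Fin b → Bool
known nothing  k = false
known (just j) k = does (j ≟ k)

-- The ideal oracle

module Hard {M n : ℕ} (lo hi : Fin M → Fin (suc n))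
  (lo-injective : ∀ {w w′} → lo w ≡ lo w′ → w ≡ w′)
  (hi-injective : ∀ {w w′} → hi w ≡ hi w′ → w ≡ w′)
  (lo<hi : ∀ w → lo w Fin.< hi w)
  (lo≢hi : ∀ w w′ → lo w ≢ hi w′)
  where

  open Matching lo hi lo-injective hi-injective lo<hi lo≢hi

  insert : Fin M → (Fin M → Bool) → Fin M → Bool
  insert w S w′ = S w′ ∨ does (w′ ≟ w)

  -- The second component is the set of slots known after the answer.
  outcomes : (q : Query (suc n)) → (Fin M → Bool) → List (Resp q × (Fin M → Bool))
  outcomes randVert    S = map (_, S) (answers (matching S) randVert)
  outcomes (randNbr x) S = map (_, S) (answers (matching S) (randNbr x))
  outcomes (deg x)     S = map (_, S) (answers (matching S) (deg x))
  outcomes randEdge    S = map (λ w → just (ends w) , insert w S) (allFin M)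
  outcomes (pair x y)  S = map (_, S) (answers (matching S) (pair x y))
  outcomes (fullNbr x) S = map (_, S) (answers (matching S) (fullNbr x))

  -- The state is the set of slots shown so far, with no reference to cells; hence different
  -- groupings of the same slots share this value.
  ideal : ∀ {a} → ℕ → ℚ → Alg a (suc n) → (Fin M → Bool) → ℚ
  ideal c d (output r)    S = 𝟙 (approx? c d r)
  ideal c d (coin k f)    S = mean (allFin (suc k)) (λ i → ideal c d (f i) S)
  ideal c d (query q p f) S = mean (outcomes q S) (λ o → ideal c d (f (proj₁ o)) (proj₂ o))

  ideal-nonNeg : ∀ {a} c d (A : Alg a (suc n)) S → 0ℚ ≤ ideal c d A S
  ideal-nonNeg c d (output r)    S = 𝟙-nonNeg (approx? c d r)
  ideal-nonNeg c d (coin k f)    S = mean-nonNeg (allFin (suc k)) (λ i → ideal-nonNeg c d (f i) S)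
  ideal-nonNeg c d (query q p f) S = mean-nonNeg (outcomes q S) (λ o → ideal-nonNeg c d (f (proj₁ o)) (proj₂ o))

  -- Both terms average over the same leaves with the same weights, and at a leaf the output cannot
  -- serve both targets.
  ideal-exclusive : ∀ {a} c d d′ → (∀ r → 𝟙 (approx? c d r) + 𝟙 (approx? c d′ r) ≤ 1ℚ) →
                    ∀ (A : Alg a (suc n)) S → ideal c d A S + ideal c d′ A S ≤ 1ℚ
  ideal-exclusive c d d′ excl (output r)    S = excl r
  ideal-exclusive c d d′ excl (coin k f)    S =
    ≤-trans (≤-reflexive (≡.sym (mean-+ (allFin (suc k)) _ _)))
            (mean-upper (allFin (suc k)) 0≤1 (λ i → ideal-exclusive c d d′ excl (f i) S))
  ideal-exclusive c d d′ excl (query q p f) S =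
    ≤-trans (≤-reflexive (≡.sym (mean-+ (outcomes q S) (λ o → ideal c d (f (proj₁ o)) (proj₂ o)) (λ o → ideal c d′ (f (proj₁ o)) (proj₂ o)))))
            (mean-upper (outcomes q S) 0≤1 (λ o → ideal-exclusive c d d′ excl (f (proj₁ o)) (proj₂ o)))

  -- Random matchings with one slot in every cell

  module Family {t b : ℕ} (at : Fin (suc t) → Fin (suc b) → Fin M)
    (cell : Fin M → Fin (suc t)) (offset : Fin M → Fin (suc b))
    (at-cell-offset : ∀ w → at (cell w) (offset w) ≡ w)
    (cell-at : ∀ i j → cell (at i j) ≡ i)
    (offset-at : ∀ i j → offset (at i j) ≡ j)
    where

    -- Splitting a slot into cell and offset is a bijection, so a uniform slot is a uniform cell
    -- followed by a uniform offset. This makes an ideal edge answer comparable with `mean-randEdge`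
    -- cell by cell.
    mean-slots : ∀ h → mean (allFin M) h ≡ mean (allFin (suc t)) (λ i → mean (allFin (suc b)) (λ j → h (at i j)))
    mean-slots h = ≡.trans (mean-↭ slots h)
      (≡.trans (mean-map (uncurry at) cells h) (mean-cartesianProduct (allFin (suc t)) (allFin (suc b)) (h ∘ uncurry at)))
      where
      cells : List (Fin (suc t) × Fin (suc b))
      cells = cartesianProduct (allFin (suc t)) (allFin (suc b))
      at-injective : ∀ {x y} → uncurry at x ≡ uncurry at y → x ≡ y
      at-injective {i , j} {i′ , j′} eq = cong₂ _,_
        (≡.trans (≡.sym (cell-at i j)) (≡.trans (cong cell eq) (cell-at i′ j′)))
        (≡.trans (≡.sym (offset-at i j)) (≡.trans (cong offset eq) (offset-at i′ j′)))
      slots : allFin M ↭ map (uncurry at) cells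
      slots = unique∧⊆⇒↭ (Unique.allFin⁺ M)
        (Unique.map⁺ at-injective (Unique.cartesianProduct⁺ (Unique.allFin⁺ (suc t)) (Unique.allFin⁺ (suc b))))
        (λ {w} _ → subst (_∈ map (uncurry at) cells) (at-cell-offset w)
          (∈-map⁺ (uncurry at) (∈-cartesianProduct⁺ (∈-allFin (cell w)) (∈-allFin (offset w)))))
        (λ {w} _ → ∈-allFin w)

    Choice : Set
    Choice = Vec (Fin (suc b)) (suc t)

    chosen : Choice → Fin M → Bool
    chosen φ w = does (lookup φ (cell w) ≟ offset w)

    slot : Choice → Fin (suc t) → Fin M
    slot φ i = at i (lookup φ i)

    G : Choice → Graph (suc n)
    G φ = matching (chosen φ)

    edges-G : ∀ φ → edges (G φ) ↭ map ends (map (slot φ) (allFin (suc t)))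
    edges-G φ = edges-matching (chosen φ) (Unique.map⁺ slot-injective (Unique.allFin⁺ (suc t))) sound complete
      where
      slot-injective : ∀ {i i′} → slot φ i ≡ slot φ i′ → i ≡ i′
      slot-injective {i} {i′} eq = ≡.trans (≡.sym (cell-at i _)) (≡.trans (cong cell eq) (cell-at i′ _))
      sound : ∀ {w} → w ∈ map (slot φ) (allFin (suc t)) → T (chosen φ w)
      sound w∈ with ∈-map⁻ (slot φ) w∈
      ... | i , _ , ≡.refl = T-does⁺ (lookup φ (cell (slot φ i)) ≟ offset (slot φ i))
        (≡.trans (cong (lookup φ) (cell-at i _)) (≡.sym (offset-at i _)))
      complete : ∀ {w} → T (chosen φ w) → w ∈ map (slot φ) (allFin (suc t))
      complete {w} h = subst (_∈ map (slot φ) (allFin (suc t)))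
        (≡.trans (cong (at (cell w)) (T-does⁻ (lookup φ (cell w) ≟ offset w) h)) (at-cell-offset w))
        (∈-map⁺ (slot φ) (∈-allFin (cell w)))

    numEdges-G : ∀ φ → numEdges (G φ) ≡ suc t
    numEdges-G φ = ≡.trans (↭-length (edges-G φ))
      (≡.trans (length-map ends (map (slot φ) (allFin (suc t)))) (≡.trans (length-map (slot φ) (allFin (suc t))) (length-tabulate {n = suc t} id)))

    d : ℚ
    d = pos (2 ℕ.* suc t) / suc n

    avgDeg-G : ∀ φ → avgDeg (G φ) ≡ d
    avgDeg-G φ = cong (λ m → pos (2 ℕ.* m) / suc n) (numEdges-G φ)

    -- There is exactly one edge per cell. The cell therefore has the same law as in an ideal
    -- answer, and only the offset is prescribed by `φ`.
    mean-randEdge : ∀ φ h → mean (answers (G φ) randEdge) h ≡ mean (allFin (suc t)) (λ i → h (just (ends (slot φ i))))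
    mean-randEdge φ h = begin
      mean (answers (G φ) randEdge) h                        ≡⟨ cong (λ xs → mean xs h) (answers-randEdge (G φ) (numEdges-G φ)) ⟩
      mean (map just (edges (G φ))) h                        ≡⟨ mean-map just (edges (G φ)) h ⟩
      mean (edges (G φ)) (h ∘ just)                          ≡⟨ mean-↭ (edges-G φ) (h ∘ just) ⟩
      mean (map ends (map (slot φ) (allFin (suc t)))) (h ∘ just) ≡⟨ mean-map ends (map (slot φ) (allFin (suc t))) (h ∘ just) ⟩
      mean (map (slot φ) (allFin (suc t))) (h ∘ just ∘ ends) ≡⟨ mean-map (slot φ) (allFin (suc t)) (h ∘ just ∘ ends) ⟩
      mean (allFin (suc t)) (λ i → h (just (ends (slot φ i)))) ∎
      where open ≡.≡-Reasoning

    Partial : Set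
    Partial = Vec (Maybe (Fin (suc b))) (suc t)

    -- Couples the two records of what has been shown: the state `S` of the ideal oracle has exactly
    -- the revealed slots of `H`, and none in hidden cells.
    Consistent : Partial → (Fin M → Bool) → Set
    Consistent H S = ∀ w → S w ≡ known (lookup H (cell w)) (offset w)

    -- Freshness leaves `S` without slots in cell `i`, so afterwards the new slot is alone there, as
    -- in the updated `H`. Other cells are untouched.
    Consistent-insert : ∀ {H S} i j → lookup H i ≡ nothing → Consistent H S →
                        Consistent (H [ i ]≔ just j) (insert (at i j) S)
    Consistent-insert {H} {S} i j fresh con w with cell w ≟ i
    ... | yes ≡.refl = begin
      S w ∨ does (w ≟ at (cell w) j)                 ≡⟨ cong (_∨ _) (≡.trans (con w) (cong (λ m → known m (offset w)) fresh)) ⟩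
      does (w ≟ at (cell w) j)                       ≡⟨ does-⇔ (mk⇔ to from) (w ≟ at (cell w) j) (j ≟ offset w) ⟩
      does (j ≟ offset w)                            ≡⟨ cong (λ m → known m (offset w)) (lookup∘update (cell w) H (just j)) ⟨
      known (lookup (H [ cell w ]≔ just j) (cell w)) (offset w) ∎
      where
      open ≡.≡-Reasoning
      to : w ≡ at (cell w) j → j ≡ offset w
      to eq = ≡.sym (≡.trans (cong offset eq) (offset-at (cell w) j))
      from : j ≡ offset w → w ≡ at (cell w) j
      from eq = ≡.trans (≡.sym (at-cell-offset w)) (cong (at (cell w)) (≡.sym eq))
    ... | no cell≢ = begin
      S w ∨ does (w ≟ at i j)                        ≡⟨ cong (S w ∨_) (dec-false (w ≟ at i j) λ eq → cell≢ (≡.trans (cong cell eq) (cell-at i j))) ⟩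
      S w ∨ false                                    ≡⟨ ∨-identityʳ (S w) ⟩
      S w                                            ≡⟨ con w ⟩
      known (lookup H (cell w)) (offset w)           ≡⟨ cong (λ m → known m (offset w)) (lookup∘update′ cell≢ H (just j)) ⟨
      known (lookup (H [ i ]≔ just j) (cell w)) (offset w) ∎
      where open ≡.≡-Reasoning

    -- In a revealed cell both sides test the offset against the same revealed value.
    chosen-known : ∀ {H S} w {j} → Consistent H S → lookup H (cell w) ≡ just j →
                   ∀ {φ} → Extends H φ → chosen φ w ≡ S w
    chosen-known w con e ext = ≡.trans (cong (λ k → does (k ≟ offset w)) (ext (cell w) e))
      (≡.sym (≡.trans (con w) (cong (λ m → known m (offset w)) e)))

    -- Replacing true answers by ideal ones

    module Bound (c : ℕ) (ε : ℚ) (K : ℕ) (0≤ε : 0ℚ ≤ ε) (hit≤ε : weight (suc b) ≤ ε)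
      (collision≤ε : ∀ {r} → r ℕ.≤ K → fromℕ r * weight (suc t) ≤ ε) where

      module _ {a} (q : Query (suc n)) (f : Resp q → Alg a (suc n)) where

        -- A hybrid run: the current answer is drawn from `as`, all later ones come from the true
        -- graph of `φ`.
        reply : List (Resp q) → Choice → ℚ
        reply as φ = mean as (λ r → accept c d (G φ) (f r))

        reply-nonNeg : ∀ as φ → 0ℚ ≤ reply as φ
        reply-nonNeg as φ = mean-nonNeg as (λ r → accept-nonNeg c d (G φ) (f r))

        reply≤1 : ∀ as φ → reply as φ ≤ 1ℚ
        reply≤1 as φ = mean-upper as 0≤1 (λ r → accept≤1 c d (G φ) (f r))

        -- If the answer depends on a single slot, there are two cases. In a revealed cell the true
        -- graph and the ideal state agree on that slot. In a hidden cell they disagree only when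
        -- `φ` hits the slot; this has probability at most ε and costs at most 1.
        replace-answers : ∀ {H S} → Consistent H S →
          (∀ S S′ → answers (matching S) q ≡ answers (matching S′) q) ⊎
          (∃ λ w → ∀ S S′ → S w ≡ S′ w → answers (matching S) q ≡ answers (matching S′) q) →
          𝔼 H (λ φ → reply (answers (G φ) q) φ) ≤ 𝔼 H (reply (answers (matching S) q)) + ε
        replace-answers {H} {S} con (inj₁ same) = ≤-trans
          (𝔼-mono H (λ φ _ → ≤-reflexive (cong (λ as → reply as φ) (same (chosen φ) S)))) (p≤p+q 0≤ε)
        replace-answers {H} {S} con (inj₂ (w , same)) with lookup H (cell w) in e
        ... | just j  = ≤-trans (𝔼-mono H (λ φ ext → ≤-reflexive
                          (cong (λ as → reply as φ) (same (chosen φ) S (chosen-known {H} {S} w con e {φ} ext))))) (p≤p+q 0≤ε)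
        ... | nothing = begin
          𝔼 H (λ φ → reply (answers (G φ) q) φ)                     ≤⟨ 𝔼-mono H (λ φ _ → pointwise φ) ⟩
          𝔼 H (λ φ → reply as φ + 𝟙 ⌊ lookup φ (cell w) ≟ offset w ⌋) ≡⟨ 𝔼-+ H (reply as) _ ⟩
          𝔼 H (reply as) + 𝔼 H (λ φ → 𝟙 ⌊ lookup φ (cell w) ≟ offset w ⌋)
                                       ≤⟨ +-monoʳ-≤ (𝔼 H (reply as)) (≤-trans (𝔼-hit H (cell w) (offset w) e) hit≤ε) ⟩
          𝔼 H (reply as) + ε                                        ∎
          where
          open ℚ.≤-Reasoning
          as = answers (matching S) q
          pointwise : ∀ φ → reply (answers (G φ) q) φ ≤ reply as φ + 𝟙 ⌊ lookup φ (cell w) ≟ offset w ⌋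
          pointwise φ with lookup φ (cell w) ≟ offset w in eq
          ... | yes _ = ≤-trans (reply≤1 (answers (G φ) q) φ) (p≤q+p (reply-nonNeg as φ))
          ... | no  _ = ≤-trans (≤-reflexive (cong (λ as → reply as φ) (same (chosen φ) S
                          (≡.trans (cong does eq) (≡.sym (≡.trans (con w) (cong (λ m → known m (offset w)) e)))))))
                          (p≤p+q ≤-refl)

        -- One ε pays for replacing the current answer; the induction hypothesis, averaged over the
        -- ideal answers, pays kε for the rest. No cell is added, so `H` and `S` stay as they are.
        local-step : ∀ {H S k} → Consistent H S →
          (∀ S S′ → answers (matching S) q ≡ answers (matching S′) q) ⊎
          (∃ λ w → ∀ S S′ → S w ≡ S′ w → answers (matching S) q ≡ answers (matching S′) q) →
          (∀ r → 𝔼 H (λ φ → accept c d (G φ) (f r)) ≤ ideal c d (f r) S + fromℕ k * ε) →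
          𝔼 H (λ φ → reply (answers (G φ) q) φ) ≤
            mean (map (_, S) (answers (matching S) q)) (λ o → ideal c d (f (proj₁ o)) (proj₂ o)) + fromℕ (suc k) * ε
        local-step {H} {S} {k} con det ih = begin
          𝔼 H (λ φ → reply (answers (G φ) q) φ)    ≤⟨ replace-answers {H} {S} con det ⟩
          𝔼 H (reply as) + ε                       ≡⟨ cong (_+ ε) (𝔼-mean H as (λ r φ → accept c d (G φ) (f r))) ⟩
          mean as (λ r → 𝔼 H (λ φ → accept c d (G φ) (f r))) + ε
                                                   ≤⟨ +-monoˡ-≤ ε (≤-trans (mean-mono as ih) (mean-+const as _ (fromℕ-*-nonNeg k 0≤ε))) ⟩
          mean as (λ r → ideal c d (f r) S) + fromℕ k * ε + ε ≡⟨ +-assoc (mean as (λ r → ideal c d (f r) S)) (fromℕ k * ε) ε ⟩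
          mean as (λ r → ideal c d (f r) S) + (fromℕ k * ε + ε) ≡⟨ cong₂ _+_ (≡.sym (mean-map (_, S) as (λ o → ideal c d (f (proj₁ o)) (proj₂ o))))
                                                                 (≡.trans (+-comm (fromℕ k * ε) ε) (≡.sym (fromℕ-suc-* k ε))) ⟩
          mean (map (_, S) as) (λ o → ideal c d (f (proj₁ o)) (proj₂ o)) + fromℕ (suc k) * ε ∎
          where
          open ℚ.≤-Reasoning
          as = answers (matching S) q

      -- Cell by cell: if the drawn cell is already revealed, the true and ideal runs may diverge,
      -- and this collision has probability at most ε. In a hidden cell the offset of the true edge
      -- is uniform given `H`, exactly as in an ideal draw, so the induction hypothesis applies
      -- after revealing it.
      edge-step : ∀ {a} (f : Resp {suc n} randEdge → Alg a (suc n)) {H S k} → revealed H ℕ.≤ K →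
        (∀ i j → lookup H i ≡ nothing → 𝔼 (H [ i ]≔ just j) (λ φ → accept c d (G φ) (f (just (ends (at i j))))) ≤
                     ideal c d (f (just (ends (at i j)))) (insert (at i j) S) + fromℕ k * ε) →
        𝔼 H (λ φ → mean (answers (G φ) randEdge) (λ r → accept c d (G φ) (f r))) ≤
          mean (outcomes randEdge S) (λ o → ideal c d (f (proj₁ o)) (proj₂ o)) + fromℕ (suc k) * ε
      edge-step f {H} {S} {k} few ih = begin
        𝔼 H (λ φ → mean (answers (G φ) randEdge) (λ r → accept c d (G φ) (f r)))
          ≤⟨ 𝔼-mono H (λ φ _ → ≤-reflexive (mean-randEdge φ (λ r → accept c d (G φ) (f r)))) ⟩
        𝔼 H (λ φ → mean (allFin (suc t)) (λ i → sp i φ))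
          ≡⟨ 𝔼-mean H (allFin (suc t)) sp ⟩
        mean (allFin (suc t)) (λ i → 𝔼 H (sp i))
          ≤⟨ mean-mono (allFin (suc t)) per-cell ⟩
        mean (allFin (suc t)) (λ i → seen i + (X i + slack))
          ≡⟨ mean-+ (allFin (suc t)) seen (λ i → X i + slack) ⟩
        mean (allFin (suc t)) seen + mean (allFin (suc t)) (λ i → X i + slack)
          ≤⟨ +-mono-≤ (≤-trans (≤-reflexive (mean-is-just H)) (collision≤ε few)) (mean-+const (allFin (suc t)) X 0≤slack) ⟩
        ε + (mean (allFin (suc t)) X + slack)
          ≡⟨ x∙yz≈y∙xz ε (mean (allFin (suc t)) X) slack ⟩
        mean (allFin (suc t)) X + (ε + slack)
          ≡⟨ cong₂ _+_ (≡.sym (≡.trans (mean-map _ (allFin M) _) (mean-slots (λ w → ideal c d (f (just (ends w))) (insert w S)))))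
                       (≡.sym (fromℕ-suc-* k ε)) ⟩
        mean (outcomes randEdge S) (λ o → ideal c d (f (proj₁ o)) (proj₂ o)) + fromℕ (suc k) * ε ∎
        where
        open ℚ.≤-Reasoning
        slack : ℚ
        slack = fromℕ k * ε
        0≤slack : 0ℚ ≤ slack
        0≤slack = fromℕ-*-nonNeg k 0≤ε
        sp : Fin (suc t) → Choice → ℚ
        sp i φ = accept c d (G φ) (f (just (ends (slot φ i))))
        seen X : Fin (suc t) → ℚ
        seen i = 𝟙 (is-just (lookup H i))
        X i = mean (allFin (suc b)) (λ j → ideal c d (f (just (ends (at i j)))) (insert (at i j) S))
        0≤X+slack : ∀ i → 0ℚ ≤ X i + slack
        0≤X+slack i = ≤-trans 0≤slack (p≤q+p (mean-nonNeg (allFin (suc b)) (λ j → ideal-nonNeg c d (f (just (ends (at i j)))) _)))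
        per-cell : ∀ i → 𝔼 H (sp i) ≤ seen i + (X i + slack)
        per-cell i with lookup H i in e
        -- Here `seen i` is 1 and absorbs the trivial bound on the true run.
        ... | just _  = ≤-trans
          (≤-trans (𝔼-mono H (λ φ _ → accept≤1 c d (G φ) (f (just (ends (slot φ i)))))) (≤-reflexive (𝔼-const H 1ℚ)))
          (p≤p+q (0≤X+slack i))
        ... | nothing = begin
          𝔼 H (sp i)                                                    ≡⟨ 𝔼-reveal H i (sp i) e ⟩
          mean (allFin (suc b)) (λ j → 𝔼 (H [ i ]≔ just j) (sp i))      ≤⟨ mean-mono (allFin (suc b)) (λ j → ≤-trans
            (𝔼-mono (H [ i ]≔ just j) (λ φ ext → ≤-reflexive
              (cong (λ k → accept c d (G φ) (f (just (ends (at i k))))) (ext i (lookup∘update i H (just j))))))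
            (ih i j e)) ⟩
          mean (allFin (suc b)) (λ j → ideal c d (f (just (ends (at i j)))) (insert (at i j) S) + slack) ≤⟨ mean-+const (allFin (suc b)) _ 0≤slack ⟩
          X i + slack                                                   ≡⟨ +-identityˡ (X i + slack) ⟨
          0ℚ + (X i + slack)                                            ∎

      -- Induction on the decision tree, each remaining query contributing ε. Bounding `revealed H`
      -- plus the remaining queries by `K` keeps the collision estimate available throughout.
      bound : ∀ {a} (A : Alg a (suc n)) {k} → QueriesAtMost k A → ∀ {H S} → Consistent H S → revealed H ℕ.+ k ℕ.≤ K →
              𝔼 H (λ φ → accept c d (G φ) A) ≤ ideal c d A S + fromℕ k * ε
      bound (output r) {k} out {H} con le = begin
        𝔼 H (λ _ → 𝟙 (approx? c d r))              ≡⟨ 𝔼-const H _ ⟩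
        𝟙 (approx? c d r)                          ≤⟨ p≤p+q (fromℕ-*-nonNeg k 0≤ε) ⟩
        𝟙 (approx? c d r) + fromℕ k * ε            ∎
        where open ℚ.≤-Reasoning
      bound (coin m f) {k} (cn Q) {H} {S} con le = begin
        𝔼 H (λ φ → mean (allFin (suc m)) (λ i → accept c d (G φ) (f i))) ≡⟨ 𝔼-mean H (allFin (suc m)) (λ i φ → accept c d (G φ) (f i)) ⟩
        mean (allFin (suc m)) (λ i → 𝔼 H (λ φ → accept c d (G φ) (f i))) ≤⟨ mean-mono (allFin (suc m)) (λ i → bound (f i) (Q i) {H} {S} con le) ⟩
        mean (allFin (suc m)) (λ i → ideal c d (f i) S + fromℕ k * ε)       ≤⟨ mean-+const (allFin (suc m)) _ (fromℕ-*-nonNeg k 0≤ε) ⟩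
        mean (allFin (suc m)) (λ i → ideal c d (f i) S) + fromℕ k * ε       ∎
        where open ℚ.≤-Reasoning
      bound (query q p f) {suc k} (qu Q) {H} {S} con le = step q p f Q
        where
        le′ : revealed H ℕ.+ k ℕ.≤ K
        le′ = ℕ.≤-trans (ℕ.+-monoʳ-≤ (revealed H) (ℕ.n≤1+n k)) le
        step : ∀ q p f → (∀ r → QueriesAtMost k (f r)) →
               𝔼 H (λ φ → accept c d (G φ) (query q p f)) ≤ ideal c d (query q p f) S + fromℕ (suc k) * ε
        step randVert    p f Q = local-step randVert f {H} {S} {k} con (inj₁ (λ _ _ → ≡.refl)) (λ r → bound (f r) (Q r) {H} {S} con le′)
        step (randNbr x) p f Q = local-step (randNbr x) f {H} {S} {k} con (answers-local randNbr) (λ r → bound (f r) (Q r) {H} {S} con le′)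
        step (deg x)     p f Q = local-step (deg x) f {H} {S} {k} con (answers-local deg) (λ r → bound (f r) (Q r) {H} {S} con le′)
        step (pair x y)  p f Q = local-step (pair x y) f {H} {S} {k} con (answers-local (pair y)) (λ r → bound (f r) (Q r) {H} {S} con le′)
        step (fullNbr x) p f Q = local-step (fullNbr x) f {H} {S} {k} con (answers-local fullNbr) (λ r → bound (f r) (Q r) {H} {S} con le′)
        -- The budget is kept: the query spent makes room for the at most one newly revealed cell.
        step randEdge    p f Q = edge-step f {H} {S} {k} (ℕ.≤-trans (ℕ.m≤m+n (revealed H) (suc k)) le)
          (λ i j e → bound (f (just (ends (at i j)))) (Q _) {H [ i ]≔ just j} {insert (at i j) S} (Consistent-insert {H} {S} i j e con)
            (ℕ.≤-trans (ℕ.+-monoˡ-≤ k (revealed-update H i j)) (ℕ.≤-trans (ℕ.≤-reflexive (≡.sym (ℕ.+-suc (revealed H) k))) le)))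

    nothing-known : Consistent (replicate (suc t) nothing) (λ _ → false)
    nothing-known w = ≡.sym (cong (λ m → known m (offset w)) (lookup-replicate (cell w) nothing))

    -- Success on every graph gives success on average over the family. `Bound.bound` then starts
    -- with nothing revealed, so the budget is `k` itself.
    ideal-lowerBound : ∀ c ε k → 0ℚ ≤ ε → weight (suc b) ≤ ε →
      (∀ {r} → r ℕ.≤ k → fromℕ r * weight (suc t) ≤ ε) →
      ∀ {a} (A : Alg a (suc n)) → QueriesAtMost k A → ∀ {p} → (∀ G → p < successProb c G A) →
      p ≤ ideal c d A (λ _ → false) + fromℕ k * ε
    ideal-lowerBound c ε k 0≤ε hit collision A Q {p} good = begin
      p                                        ≡⟨ 𝔼-const H₀ p ⟨
      𝔼 H₀ (λ _ → p)                           ≤⟨ 𝔼-mono H₀ (λ φ _ → ≤-trans (<⇒≤ (good (G φ))) (≤-reflexive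
                                                    (≡.trans (successProb≡accept c (G φ) A) (cong (λ δ → accept c δ (G φ) A) (avgDeg-G φ))))) ⟩
      𝔼 H₀ (λ φ → accept c d (G φ) A)          ≤⟨ Bound.bound c ε k 0≤ε hit collision A Q {H₀} {λ _ → false} nothing-known
                                                    (ℕ.≤-reflexive (cong (ℕ._+ k) (revealed-nothing (suc t)))) ⟩
      ideal c d A (λ _ → false) + fromℕ k * ε  ∎
      where
      open ℚ.≤-Reasoning
      H₀ : Partial
      H₀ = replicate (suc t) nothing

-- The two families

/-mono⁻ : ∀ a b n → pos a / suc n ≤ pos b / suc n → a ℕ.≤ b
/-mono⁻ a b n le = ℤ.drop‿+≤+ (ℤ.*-cancelʳ-≤-pos (pos a) (pos b) (pos (suc n)) (ℚᵘ.drop-*≤* (begin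
  mkℚᵘ (pos a) n          ≃⟨ toℚᵘ-/ (pos a) n ⟨
  toℚᵘ (pos a / suc n)    ≤⟨ toℚᵘ-mono-≤ le ⟩
  toℚᵘ (pos b / suc n)    ≃⟨ toℚᵘ-/ (pos b) n ⟩
  mkℚᵘ (pos b) n          ∎)))
  where open ℚᵘ.≤-Reasoning

/1-*-/ : ∀ a b n → (pos a / 1) * (pos b / suc n) ≡ pos (a ℕ.* b) / suc n
/1-*-/ a b n = toℚᵘ-injective (begin
  toℚᵘ ((pos a / 1) * (pos b / suc n))          ≈⟨ toℚᵘ-homo-* (pos a / 1) (pos b / suc n) ⟩
  toℚᵘ (pos a / 1) ℚᵘ.* toℚᵘ (pos b / suc n)    ≈⟨ ℚᵘ.*-cong (toℚᵘ-/ (pos a) 0) (toℚᵘ-/ (pos b) n) ⟩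
  mkℚᵘ (pos a) 0 ℚᵘ.* mkℚᵘ (pos b) n            ≈⟨ *≡* (cong₂ ℤ._*_ (≡.sym (ℤ.pos-* a b)) (cong (λ m → pos (suc m)) (≡.sym (ℕ.+-identityʳ n)))) ⟩
  mkℚᵘ (pos (a ℕ.* b)) n                        ≈⟨ toℚᵘ-/ (pos (a ℕ.* b)) n ⟨
  toℚᵘ (pos (a ℕ.* b) / suc n)                  ∎)
  where open ℚᵘ.≃-Reasoning

-- A common value r would give d′ ≤ c r ≤ c² d for the two degrees d and d′, against `far`.
Approx-disjoint : ∀ c m m′ n r → c ℕ.* (c ℕ.* m) ℕ.< m′ →
                  ¬ (Approx c (pos m / suc n) r × Approx c (pos m′ / suc n) r)
Approx-disjoint c m m′ n r far ((_ , r≤) , (≤r , _)) = ℕ.<⇒≱ far (/-mono⁻ m′ (c ℕ.* (c ℕ.* m)) n (begin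
  pos m′ / suc n                                 ≤⟨ ≤r ⟩
  (pos c / 1) * r                                ≤⟨ *-monoˡ-≤-nonNeg (pos c / 1) {{normalize-nonNeg c 1}} r≤ ⟩
  (pos c / 1) * ((pos c / 1) * (pos m / suc n))  ≡⟨ cong ((pos c / 1) *_) (/1-*-/ c m n) ⟩
  (pos c / 1) * (pos (c ℕ.* m) / suc n)          ≡⟨ /1-*-/ c (c ℕ.* m) n ⟩
  pos (c ℕ.* (c ℕ.* m)) / suc n                  ∎))
  where open ℚ.≤-Reasoning

𝟙-exclusive : ∀ {P Q : Set} (P? : Dec P) (Q? : Dec Q) → ¬ (P × Q) → 𝟙 ⌊ P? ⌋ + 𝟙 ⌊ Q? ⌋ ≤ 1ℚ
𝟙-exclusive (yes p) (yes q) ¬pq = contradiction (p , q) ¬pq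
𝟙-exclusive (yes p) (no _)  ¬pq = ≤-reflexive (+-identityʳ 1ℚ)
𝟙-exclusive (no _)  Q?      ¬pq = ≤-trans (≤-reflexive (+-identityˡ (𝟙 ⌊ Q? ⌋))) (𝟙≤1 ⌊ Q? ⌋)

approx?-exclusive : ∀ c d d′ r → ¬ (Approx c d r × Approx c d′ r) → 𝟙 (approx? c d r) + 𝟙 (approx? c d′ r) ≤ 1ℚ
approx?-exclusive c d d′ r = 𝟙-exclusive (close? d) (close? d′)
  where
  close? : ∀ δ → Dec (Approx c δ r)
  close? δ = (δ ℚ.≤? (pos c / 1) * r) ×-dec (r ℚ.≤? (pos c / 1) * δ)

weight-antitone : ∀ d m → suc d ℕ.≤ suc m → weight (suc m) ≤ weight (suc d)
weight-antitone d m le = ≤-trans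
  (≤-reflexive (≡.sym (≡.trans (cong (_* weight (suc m)) fromℕ1) (*-identityˡ (weight (suc m))))))
  (fromℕ*weight≤weight 1 d m (≡.subst (ℕ._≤ suc m) (≡.sym (ℕ.*-identityˡ (suc d))) le))
  where
  fromℕ1 : fromℕ 1 ≡ 1ℚ
  fromℕ1 = ≡.trans (fromℕ-suc 0) (≡.trans (cong (1ℚ +_) fromℕ-zero) (+-identityʳ 1ℚ))

-- The slots seen as a grid. Stating the size as an equation with `M` lets grids of different shapes
-- address the same slots.
module Cells {m n M : ℕ} (eq : m ℕ.* n ≡ M) where

  at : Fin m → Fin n → Fin M
  at i j = cast eq (combine i j)

  index : Fin M → Fin m × Fin n
  index w = remQuot n (cast (≡.sym eq) w)

  at-index : ∀ w → at (proj₁ (index w)) (proj₂ (index w)) ≡ w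
  at-index w = ≡.trans (cong (cast eq) (combine-remQuot {m} n (cast (≡.sym eq) w))) (cast-involutive eq (≡.sym eq) w)

  index-at : ∀ i j → index (at i j) ≡ (i , j)
  index-at i j = ≡.trans (cong (remQuot n) (cast-involutive (≡.sym eq) eq (combine i j))) (remQuot-combine i j)

-- A concrete system of disjoint slots. Vertices from 2M on lie in no slot and stay isolated, so any
-- number of vertices from 2M on can be used.
module Halves {M n : ℕ} (fits : M ℕ.+ M ℕ.≤ n) where

  lo hi : Fin M → Fin n
  lo w = inject≤ w (ℕ.≤-trans (ℕ.m≤m+n M M) fits)
  hi w = inject≤ (M ↑ʳ w) fits

  toℕ-lo : ∀ w → toℕ (lo w) ≡ toℕ w
  toℕ-lo w = toℕ-inject≤ w _

  toℕ-hi : ∀ w → toℕ (hi w) ≡ M ℕ.+ toℕ w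
  toℕ-hi w = ≡.trans (toℕ-inject≤ (M ↑ʳ w) fits) (toℕ-↑ʳ M w)

  lo-injective : ∀ {w w′} → lo w ≡ lo w′ → w ≡ w′
  lo-injective {w} {w′} eq = toℕ-injective (≡.trans (≡.sym (toℕ-lo w)) (≡.trans (cong toℕ eq) (toℕ-lo w′)))

  hi-injective : ∀ {w w′} → hi w ≡ hi w′ → w ≡ w′
  hi-injective {w} {w′} eq = toℕ-injective (ℕ.+-cancelˡ-≡ M (toℕ w) (toℕ w′)
    (≡.trans (≡.sym (toℕ-hi w)) (≡.trans (cong toℕ eq) (toℕ-hi w′))))

  lo<hi′ : ∀ w w′ → lo w Fin.< hi w′
  lo<hi′ w w′ = ≡.subst₂ ℕ._<_ (≡.sym (toℕ-lo w)) (≡.sym (toℕ-hi w′)) (ℕ.<-≤-trans (toℕ<n w) (ℕ.m≤m+n M (toℕ w′)))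

  lo≢hi : ∀ w w′ → lo w ≢ hi w′
  lo≢hi w w′ = Fin.<⇒≢ (lo<hi′ w w′)

module TwoFamilies (c k n : ℕ) where

  L B R : ℕ
  -- `L` exceeds c² and separates the degrees. `B` makes the total error k/B at most 1/7, and `R`
  -- makes the collision chance k/R at most 1/B.
  L = suc (c ℕ.* c)
  B = 7 ℕ.* suc k
  R = B ℕ.* suc k

  impossible : R ℕ.* (L ℕ.* B) ℕ.+ R ℕ.* (L ℕ.* B) ℕ.≤ suc n →
    ∀ {a} (A : Alg a (suc n)) → QueriesAtMost k A → ¬ (∀ G → pos 2 / 3 < successProb c G A)
  -- The contradiction is 4/3 ≤ 9/7. An error of 1/6 per family would only give 4/3 ≤ 4/3, hence the
  -- factor 7 in `B`.
  impossible fits A Q good = from-no ((pos 2 / 3) + (pos 2 / 3) ℚ.≤? 1ℚ + ((pos 1 / 7) + (pos 1 / 7))) (begin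
    (pos 2 / 3) + (pos 2 / 3)               ≤⟨ +-mono-≤ few many ⟩
    (x + s) + (y + s)                       ≡⟨ interchange x s y s ⟩
    (x + y) + (s + s)                       ≤⟨ +-mono-≤ exclusive (+-mono-≤ s≤1/7 s≤1/7) ⟩
    1ℚ + ((pos 1 / 7) + (pos 1 / 7))        ∎)
    where
    open ℚ.≤-Reasoning
    M : ℕ
    M = R ℕ.* (L ℕ.* B)
    open Halves {M} fits
    open Hard lo hi lo-injective hi-injective (λ w → lo<hi′ w w) lo≢hi
    -- The sparse family has R cells of L B slots, the dense one R L cells of B slots.
    module C₁ = Cells {R} {L ℕ.* B} {M} ≡.refl
    module C₂ = Cells {R ℕ.* L} {B} {M} (ℕ.*-assoc R L B)
    module F₁ = Family {pred R} {pred (L ℕ.* B)} C₁.at (λ w → proj₁ (C₁.index w)) (λ w → proj₂ (C₁.index w))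
      C₁.at-index (λ i j → cong proj₁ (C₁.index-at i j)) (λ i j → cong proj₂ (C₁.index-at i j))
    module F₂ = Family {pred (R ℕ.* L)} {pred B} C₂.at (λ w → proj₁ (C₂.index w)) (λ w → proj₂ (C₂.index w))
      C₂.at-index (λ i j → cong proj₁ (C₂.index-at i j)) (λ i j → cong proj₂ (C₂.index-at i j))
    ε s x y : ℚ
    ε = weight B
    s = fromℕ k * ε
    x = ideal c F₁.d A (λ _ → false)
    y = ideal c F₂.d A (λ _ → false)
    0≤ε : 0ℚ ≤ ε
    0≤ε = nonNegative⁻¹ ε {{weight-nonNeg B}}
    s≤1/7 : s ≤ pos 1 / 7
    s≤1/7 = ≤-trans (fromℕ*weight≤weight k 6 (pred B)
      (ℕ.≤-trans (ℕ.≤-reflexive (ℕ.*-comm k 7)) (ℕ.*-monoʳ-≤ 7 (ℕ.n≤1+n k)))) (≤-reflexive (weight-suc 6))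
    r*B≤R : ∀ {r} → r ℕ.≤ k → r ℕ.* B ℕ.≤ R
    r*B≤R {r} r≤k = ℕ.≤-trans (ℕ.≤-reflexive (ℕ.*-comm r B)) (ℕ.*-monoʳ-≤ B (ℕ.m≤n⇒m≤1+n r≤k))
    few : pos 2 / 3 ≤ x + s
    -- The larger cells of this family are hit with chance 1/(L B), which is at most ε = 1/B.
    few = F₁.ideal-lowerBound c ε k 0≤ε (weight-antitone (pred B) (pred (L ℕ.* B)) (ℕ.m≤m+n B (c ℕ.* c ℕ.* B)))
      (λ {r} r≤k → fromℕ*weight≤weight r (pred B) (pred R) (r*B≤R r≤k)) A Q good
    many : pos 2 / 3 ≤ y + s
    many = F₂.ideal-lowerBound c ε k 0≤ε ≤-refl
      (λ {r} r≤k → fromℕ*weight≤weight r (pred B) (pred (R ℕ.* L)) (ℕ.≤-trans (r*B≤R r≤k) (ℕ.m≤m*n R L))) A Q good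
    far : c ℕ.* (c ℕ.* (2 ℕ.* R)) ℕ.< 2 ℕ.* (R ℕ.* L)
    -- The two sides differ by exactly 2R, because L = c² + 1.
    far = ℕ.≤-trans (ℕ.m<n+m (c ℕ.* (c ℕ.* (2 ℕ.* R))) {2 ℕ.* R} (ℕ.s≤s ℕ.z≤n)) (ℕ.≤-reflexive (identity c R))
      where
      open +-*-Solver
      identity : ∀ c R → 2 ℕ.* R ℕ.+ c ℕ.* (c ℕ.* (2 ℕ.* R)) ≡ 2 ℕ.* (R ℕ.* suc (c ℕ.* c))
      identity = solve 2 (λ c R → con 2 :* R :+ c :* (c :* (con 2 :* R)) := con 2 :* (R :* (con 1 :+ c :* c))) ≡.refl
    exclusive : x + y ≤ 1ℚ
    exclusive = ideal-exclusive c F₁.d F₂.d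
      (λ r → approx?-exclusive c F₁.d F₂.d r (Approx-disjoint c (2 ℕ.* R) (2 ℕ.* (R ℕ.* L)) n r far)) A (λ _ → false)

-- Constants and exponents

lowerBound₃ : ∀ a → LowerBound a 3
-- The slots occupy 2M = 98 L (k + 1)³ vertices. For positive k, k + 1 ≤ 2k turns this into 784 L k³
-- with 784 = 8 · 98; the threshold 98 L covers k = 0.
lowerBound₃ a c _ = 784 ℕ.* L , 98 ℕ.* L , ℕ.s≤s ℕ.z≤n , bound
  where
  L : ℕ
  L = suc (c ℕ.* c)
  slots : ∀ k → let B = 7 ℕ.* suc k; R = B ℕ.* suc k in
          R ℕ.* (L ℕ.* B) ℕ.+ R ℕ.* (L ℕ.* B) ≡ 98 ℕ.* L ℕ.* suc k ℕ.^ 3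
  slots k = identity L (suc k)
    where
    open +-*-Solver
    identity : ∀ L κ → 7 ℕ.* κ ℕ.* κ ℕ.* (L ℕ.* (7 ℕ.* κ)) ℕ.+ 7 ℕ.* κ ℕ.* κ ℕ.* (L ℕ.* (7 ℕ.* κ)) ≡ 98 ℕ.* L ℕ.* κ ℕ.^ 3
    identity = solve 2 (λ L κ → con 7 :* κ :* κ :* (L :* (con 7 :* κ)) :+ con 7 :* κ :* κ :* (L :* (con 7 :* κ)) := con 98 :* L :* κ :^ 3) ≡.refl
  doubling : ∀ k → 98 ℕ.* L ℕ.* (suc k ℕ.+ suc k) ℕ.^ 3 ≡ 784 ℕ.* L ℕ.* suc k ℕ.^ 3
  doubling k = identity L (suc k)
    where
    open +-*-Solver
    identity : ∀ L κ → 98 ℕ.* L ℕ.* (κ ℕ.+ κ) ℕ.^ 3 ≡ 784 ℕ.* L ℕ.* κ ℕ.^ 3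
    identity = solve 2 (λ L κ → con 98 :* L :* (κ :+ κ) :^ 3 := con 784 :* L :* κ :^ 3) ≡.refl
  roomy : ∀ k n → 98 ℕ.* L ℕ.≤ suc n → 784 ℕ.* L ℕ.* k ℕ.^ 3 ℕ.< suc n → 98 ℕ.* L ℕ.* suc k ℕ.^ 3 ℕ.≤ suc n
  roomy zero    n n₀≤ _  = ℕ.≤-trans (ℕ.≤-reflexive (ℕ.*-identityʳ (98 ℕ.* L))) n₀≤
  roomy (suc k) n _   lt = begin
    98 ℕ.* L ℕ.* suc (suc k) ℕ.^ 3          ≤⟨ ℕ.*-monoʳ-≤ (98 ℕ.* L) (ℕ.^-monoˡ-≤ 3 (ℕ.+-monoˡ-≤ (suc k) {1} {suc k} (ℕ.s≤s ℕ.z≤n))) ⟩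
    98 ℕ.* L ℕ.* (suc k ℕ.+ suc k) ℕ.^ 3    ≡⟨ doubling k ⟩
    784 ℕ.* L ℕ.* suc k ℕ.^ 3               ≤⟨ ℕ.<⇒≤ lt ⟩
    suc n                                   ∎
    where open ℕ.≤-Reasoning
  bound : ∀ n → 98 ℕ.* L ℕ.≤ suc n → ∀ (A : Alg a (suc n)) k → QueriesAtMost k A →
          (∀ G → pos 2 / 3 < successProb c G A) → suc n ℕ.≤ 784 ℕ.* L ℕ.* k ℕ.^ 3
  bound n n₀≤ A k Q good = ℕ.≮⇒≥ λ lt → TwoFamilies.impossible c k n
    (ℕ.≤-trans (ℕ.≤-reflexive (slots k)) (roomy k n n₀≤ lt)) A Q good

-- Powers of a positive k grow with the exponent. For k = 0 a positive starting exponent matters,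
-- since 0 to the power 0 is 1.
weaken-exponent : ∀ {a} e → LowerBound a (suc e) → LowerBound a (suc (suc e))
weaken-exponent e bound c 1≤c with bound c 1≤c
... | C , n₀ , 1≤C , f = C , n₀ , 1≤C , λ n n₀≤ A k Q good → ℕ.≤-trans (f n n₀≤ A k Q good) (ℕ.*-monoʳ-≤ C (power k))
  where
  power : ∀ k → k ℕ.^ suc e ℕ.≤ k ℕ.^ suc (suc e)
  power zero    = ℕ.z≤n
  power (suc k) = ℕ.m≤m+n (suc k ℕ.^ suc e) (k ℕ.* suc k ℕ.^ suc e)

theorem5p1 : LowerBound basic 3 × LowerBound withPair 4 × LowerBound withFull 5
theorem5p1 = lowerBound₃ basic ,
             weaken-exponent 2 (lowerBound₃ withPair) ,
             weaken-exponent 3 (weaken-exponent 2 (lowerBound₃ withFull))
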